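{- For any integer $k\ge 3$ and real $\varepsilon>0$ there exists $n_0=n_0(\varepsilon)$ such that if $n\ge n_0$ and $\mathcal{F}\subseteq\tilde{B}_n$ with $|\mathcal{F}|=(1+\varepsilon)\binom{n}{\lfloor n/2\rfloor}$, then $\mathcal{F}$ contains a strong copy $\mathcal{G}$ of $P_{2k-1}$, given by a bijection $p\mapsto G_p$, such that $G_{a_i}\not\subseteq G_{a_1}\cup G_{a_k}$ for all $i=2,\dots,k-1$.
   Context: $[n]=\{1,\dots,n\}$ and $\tilde{B}_n=\{F\subseteq[n]: ||F|-n/2|\le 2\sqrt{n\ln n}\}$. A family $\mathcal{G}$ is a strong copy of a poset $(P,\leqslant)$ if there is a bijection $f:P\to\mathcal{G}$ with $p\leqslant q\iff f(p)\subseteq f(q)$; we write $G_p=f(p)$. $P_{2k-1}$ is the poset on $2k-1$ elements $a_1,\dots,a_k,b_1,\dots,b_{k-1}$ whose only relations are $a_i<b_i$ and $a_{i+1}<b_i$ for $i=1,\dots,k-1$. -}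

module Defs where

open import Data.Nat using (ℕ; zero; suc; _+_; _*_; _∸_; _^_; _≤_; _<_; _!)
open import Data.Fin using (Fin; toℕ)
open import Data.Fin.Subset using (Subset; ∣_∣)
open import Data.Sum using (_⊎_; inj₁; inj₂)
open import Data.Empty using (⊥)
open import Relation.Binary.PropositionalEquality using (_≡_)

absDiff : ℕ → ℕ → ℕ
absDiff a b = (a ∸ b) + (b ∸ a)

-- expPartialScaled m K = K! * Σ_{j=0}^{K} m^j / j!  (a natural number),
-- via the recurrence S 0 = 1, S (K+1) = (K+1) * S K + m^(K+1).
expPartialScaled : ℕ → ℕ → ℕ
expPartialScaled m zero    = 1
expPartialScaled m (suc K) = suc K * expPartialScaled m K + m ^ suc K

-- e^m ≤ N  (real exponential), expressed as: every partial sum of the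
-- series Σ_j m^j / j! (which increase to e^m) is ≤ N.
ExpLe : ℕ → ℕ → Set
ExpLe m N = ∀ (K : ℕ) → expPartialScaled m K ≤ N * (K !)

-- F ∈ B̃_n  :⇔  | |F| - n/2 | ≤ 2 √(n ln n)
--           ⇔  (2|F| - n)² ≤ 16 n ln n
--           ⇔  e^{(2|F| - n)²} ≤ n^{16 n}          (for n ≥ 1)
InBtilde : (n : ℕ) → Subset n → Set
InBtilde n F = ExpLe (d * d) (n ^ (16 * n))
  where
  d = absDiff (2 * ∣ F ∣) n

-- The poset P_{2k-1}: elements a_i (inj₁ i, i : Fin k, 0-indexed)
-- and b_j (inj₂ j, j : Fin (k ∸ 1), 0-indexed).
PElt : ℕ → Set
PElt k = Fin k ⊎ Fin (k ∸ 1)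

_≼_ : ∀ {k} → PElt k → PElt k → Set
inj₁ i ≼ inj₁ i' = i ≡ i'
inj₂ j ≼ inj₂ j' = j ≡ j'
inj₁ i ≼ inj₂ j = (toℕ i ≡ toℕ j) ⊎ (toℕ i ≡ suc (toℕ j))
inj₂ _ ≼ inj₁ _ = ⊥

{-# OPTIONS --safe #-}

-- Count maximal chains. Give A the weight W A = |A|! (n - |A|)!, the number of maximal chains
-- through A; since W A is at least n! / (n choose n/2), a maximal chain meets the family at
-- least 1 + ε times on average, so a positive proportion of all incidences (chain, member)
-- begin a pair A ⊂ B of consecutive members. Deleting members of relatively low degree leaves
-- lower members 𝓐 and upper members 𝓑 such that a random chain up from any A ∈ 𝓐 (down from
-- any B ∈ 𝓑) next meets the family in 𝓑 (in 𝓐) with probability bounded below. All members have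
-- size n/2 + o(n), so such a chain switches a prescribed element, or stays below a prescribed
-- nearby member, only with probability o(1). Hence a fence can be grown greedily, each
-- step fixing one coordinate that separates an earlier member from all later ones.
--
-- For the condition on a₁ and a_k, fix an element w. All members except a₁ and a_k are chosen
-- to contain w, and a₁, a_k lie on chains whose first step down from b₁, b_{k-1} removes w.
-- Averaging over w shows that for some w enough upper members B admit such a chain.

module Submission where

open import Defs
open import Data.Nat
open import Data.Nat.Properties
open import Data.Nat.DivMod using (m/n*n≤m; m/n*n≡m; m*n/n≡m; /-monoˡ-≤; m≡m%n+[m/n]*n; m%n<n; m≥n⇒m/n>0)
open import Data.Nat.Combinatorics using (_C_; k![n∸k]!∣n!; nCk≡n!/k![n-k]!)
open import Data.Nat.Tactic.RingSolver using (solve-∀)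
open import Algebra.Properties.Semiring.Sum +-*-semiring
  using (sum; sum-syntax; sum-cong-≗; ∑-distrib-+; *-distribˡ-sum)
open import Data.Integer as ℤ using (+[1+_])
import Data.Integer.Properties as ℤ
open import Data.Rational as ℚ using (ℚ; 0ℚ; 1ℚ; mkℚ; toℚᵘ) renaming (_+_ to _+ℚ_; _*_ to _*ℚ_; _<_ to _<ℚ_; _/_ to _/ℚ_)
import Data.Rational.Properties as ℚ
open import Data.Rational.Unnormalised as ℚᵘ using (mkℚᵘ; *≡*)
import Data.Rational.Unnormalised.Properties as ℚᵘ
open import Data.Bool as Bool using (Bool; true; false; not; if_then_else_; _xor_; _∧_)
open import Data.Bool.Properties using (not-involutive; not-¬; ¬-not)
open import Data.Fin as Fin using (Fin; zero; suc; toℕ)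
open import Data.Fin.Properties using (all?; ¬∀⟶∃¬; toℕ-injective; toℕ≤pred[n])
open import Data.Fin.Subset using (Subset; ∣_∣; _⊆_; _∪_)
open import Data.Fin.Subset.Properties using (anySubset?; x∈p∪q⁻)
open import Data.Vec using ([]; _∷_; lookup; _[_]≔_)
open import Data.Vec.Properties using (lookup∘update; lookup∘update′; ≡-dec; []=⇒lookup; lookup⇒[]=)
open import Data.List using (List; []; _∷_; length; map)
open import Data.List.Properties using (length-map)
open import Data.List.Relation.Unary.All as All using (All; []; _∷_; universal)
import Data.List.Relation.Unary.All.Properties as All
open import Data.List.Relation.Unary.Any using (here; there)
open import Data.List.Relation.Unary.AllPairs using ([]; _∷_)
open import Data.List.Relation.Unary.Unique.Propositional using (Unique)
open import Data.List.Membership.Propositional using (_∈_)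
import Data.List.Membership.DecPropositional as DecMembership
open import Data.Product using (∃-syntax; Σ-syntax; _×_; _,_; proj₁; proj₂)
open import Data.Sum using (_⊎_; inj₁; inj₂)
open import Data.Empty using (⊥-elim)
open import Function using (_∘_)
open import Function.Definitions using (Injective)
open import Function.Bundles using (_⇔_; mk⇔)
open import Relation.Binary using (tri<; tri≈; tri>)
open import Relation.Binary.PropositionalEquality
open import Relation.Nullary using (¬_; Dec; does; yes; no; contradiction)
open import Relation.Nullary.Decidable using (_→-dec_; _×-dec_)

-- No probability space appears: a chain leaving S in direction `b` has `rem b S !` continuations,
-- every probability is a count divided by that factorial, and estimates are stated with
-- denominators cleared. The direction `b` lets one argument serve chains going up and chains going
-- down. Rare events are rare because `rem b T` lies between `lo` and `lo + s` for all members T,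
-- with s / lo as small as desired: beyond this band a chain meets no member. The obstacle is the
-- step that removes w. A prescribed first step has probability about 2 / n, so no lower bound on
-- the degree of B controls what follows it. Hence `good` is a separate demand on upper members; it
-- refers to the whole family, so deletions cannot spoil it, and a₁ and a_k need only be members,
-- not survivors in 𝓐. With 1 + ε = N / (1 + q), the constant 256 N² collects a share 1 / (2N) of
-- the weight for pairs under members of high degree, a share 1 / (16N) of good elements, 1 / 2 for
-- chains that keep w, and 4 for the two weights to be beaten and a strict inequality.

private variable
  n : ℕ

-- Sums over coordinates and over subsets

-- The gate binds tighter than + and looser than *, so `c ▸ u * v` gates the whole product.
infixr 6.5 _▸_
_▸_ : Bool → ℕ → ℕ
true  ▸ v = v
false ▸ v = 0

▸-mono : ∀ c {u v} → (c ≡ true → u ≤ v) → c ▸ u ≤ c ▸ v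
▸-mono true  h = h refl
▸-mono false h = z≤n

▸-cong : ∀ c {u v} → (c ≡ true → u ≡ v) → c ▸ u ≡ c ▸ v
▸-cong true  h = h refl
▸-cong false h = refl

▸-+ : ∀ c u v → c ▸ (u + v) ≡ c ▸ u + c ▸ v
▸-+ true  u v = refl
▸-+ false u v = refl

▸-*ˡ : ∀ c u v → u * (c ▸ v) ≡ c ▸ u * v
▸-*ˡ true  u v = refl
▸-*ˡ false u v = *-zeroʳ u

▸-≤ : ∀ c v → c ▸ v ≤ v
▸-≤ true  v = ≤-refl
▸-≤ false v = z≤n

+-<-split : ∀ {a b c d} → a + b < c + d → a < c ⊎ b < d
+-<-split {a} {b} {c} {d} h with a <? c | b <? d
... | yes p | _     = inj₁ p
... | no _  | yes q = inj₂ q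
... | no p  | no q  = contradiction h (≤⇒≯ (+-mono-≤ (≮⇒≥ p) (≮⇒≥ q)))

∑-mono : {f g : Fin n → ℕ} → (∀ i → f i ≤ g i) → sum f ≤ sum g
∑-mono {zero}  h = z≤n
∑-mono {suc n} h = +-mono-≤ (h zero) (∑-mono (h ∘ suc))

∑-const : ∀ n c → ∑[ i < n ] c ≡ n * c
∑-const zero    c = refl
∑-const (suc n) c = cong (c +_) (∑-const n c)

∑-▸ : ∀ (c : Fin n → Bool) v → ∑[ i < n ] (c i ▸ v) ≡ v * ∑[ i < n ] (c i ▸ 1)
∑-▸ c v = trans (sum-cong-≗ λ i → trans (cong (c i ▸_) (sym (*-identityʳ v))) (sym (▸-*ˡ (c i) v 1)))
  (sym (*-distribˡ-sum v (λ i → c i ▸ 1)))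

∑-indicator : ∀ (x : Fin n) c → ∑[ z < n ] (does (z Fin.≟ x) ▸ c) ≡ c
∑-indicator {suc n} zero    c = trans (cong (c +_) (trans (∑-const n 0) (*-zeroʳ n))) (+-identityʳ c)
∑-indicator {suc n} (suc x) c = ∑-indicator x c

∑-<-witness : {f g : Fin n → ℕ} → sum f < sum g → ∃[ i ] f i < g i
∑-<-witness {suc n} {f} h with +-<-split {f zero} h
... | inj₁ p = zero , p
... | inj₂ q with ∑-<-witness q
...   | i , r = suc i , r

∑S : (Subset n → ℕ) → ℕ
∑S {zero}  φ = φ []
∑S {suc n} φ = ∑S (φ ∘ (false ∷_)) + ∑S (φ ∘ (true ∷_))

∑S-cong : {f g : Subset n → ℕ} → (∀ S → f S ≡ g S) → ∑S f ≡ ∑S g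
∑S-cong {zero}  h = h []
∑S-cong {suc n} h = cong₂ _+_ (∑S-cong (h ∘ (false ∷_))) (∑S-cong (h ∘ (true ∷_)))

∑S-mono : {f g : Subset n → ℕ} → (∀ S → f S ≤ g S) → ∑S f ≤ ∑S g
∑S-mono {zero}  h = h []
∑S-mono {suc n} h = +-mono-≤ (∑S-mono (h ∘ (false ∷_))) (∑S-mono (h ∘ (true ∷_)))

+-interchange : ∀ a b c d → (a + b) + (c + d) ≡ (a + c) + (b + d)
+-interchange = solve-∀

∑S-+ : (f g : Subset n → ℕ) → ∑S (λ S → f S + g S) ≡ ∑S f + ∑S g
∑S-+ {zero}  f g = refl
∑S-+ {suc n} f g = trans (cong₂ _+_ (∑S-+ (f ∘ (false ∷_)) (g ∘ (false ∷_))) (∑S-+ (f ∘ (true ∷_)) (g ∘ (true ∷_))))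
  (+-interchange (∑S (f ∘ (false ∷_))) (∑S (g ∘ (false ∷_))) (∑S (f ∘ (true ∷_))) (∑S (g ∘ (true ∷_))))

∑S-* : ∀ c (f : Subset n → ℕ) → ∑S (λ S → c * f S) ≡ c * ∑S f
∑S-* {zero}  c f = refl
∑S-* {suc n} c f = trans (cong₂ _+_ (∑S-* c (f ∘ (false ∷_))) (∑S-* c (f ∘ (true ∷_))))
  (sym (*-distribˡ-+ c (∑S (f ∘ (false ∷_))) _))

∑S-∑ : ∀ {m} (f : Fin m → Subset n → ℕ) → ∑S (λ S → ∑[ i < m ] (f i S)) ≡ ∑[ i < m ] (∑S (f i))
∑S-∑ {zero}  f = refl
∑S-∑ {suc n} f = trans (cong₂ _+_ (∑S-∑ (λ i → f i ∘ (false ∷_))) (∑S-∑ (λ i → f i ∘ (true ∷_))))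
  (sym (∑-distrib-+ (λ i → ∑S (f i ∘ (false ∷_))) (λ i → ∑S (f i ∘ (true ∷_)))))

term≤∑S : (f : Subset n → ℕ) → ∀ S → f S ≤ ∑S f
term≤∑S f []          = ≤-refl
term≤∑S f (false ∷ S) = ≤-trans (term≤∑S (f ∘ (false ∷_)) S) (m≤m+n _ _)
term≤∑S f (true ∷ S)  = ≤-trans (term≤∑S (f ∘ (true ∷_)) S) (m≤n+m _ _)

∑S-<-witness : {f g : Subset n → ℕ} → ∑S f < ∑S g → ∃[ S ] f S < g S
∑S-<-witness {zero}  h = [] , h
∑S-<-witness {suc n} {f} h with +-<-split {∑S (f ∘ (false ∷_))} h
... | inj₁ p = let S , r = ∑S-<-witness p in false ∷ S , r
... | inj₂ q = let S , r = ∑S-<-witness q in true ∷ S , r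

∑S-zero : ∀ n → ∑S {n} (λ _ → 0) ≡ 0
∑S-zero zero  = refl
∑S-zero (suc n) = cong₂ _+_ (∑S-zero n) (∑S-zero n)

∑S-positive : {f : Subset n → ℕ} → 0 < ∑S f → ∃[ S ] 0 < f S
∑S-positive {n} {f} h = ∑S-<-witness (subst (_< ∑S f) (sym (∑S-zero n)) h)

-- U b sums over the covers (b = true) or the cocovers (b = false) of S.
U : Bool → (Subset n → ℕ) → Subset n → ℕ
U {n} b φ S = ∑[ x < n ] ((lookup S x xor b) ▸ φ (S [ x ]≔ b))

-- rem false S = |S| and rem true S = n - |S|.
rem : Bool → Subset n → ℕ
rem {n} b S = ∑[ x < n ] ((lookup S x xor b) ▸ 1)

xor-true : ∀ a b → a xor b ≡ true → a ≡ not b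
xor-true true  false _ = refl
xor-true false true  _ = refl

xor-false : ∀ a b → a xor b ≡ false → a ≡ b
xor-false true  true  _ = refl
xor-false false false _ = refl

not-xor : ∀ b → not b xor b ≡ true
not-xor true = refl
not-xor false = refl

xor-same : ∀ b → b xor b ≡ false
xor-same true = refl
xor-same false = refl

module _ {b : Bool} {S : Subset n} where

  U-≤ : ∀ φ {c : Fin n → ℕ} → (∀ x → lookup S x ≡ not b → φ (S [ x ]≔ b) ≤ c x) →
        U b φ S ≤ ∑[ x < n ] ((lookup S x xor b) ▸ c x)
  U-≤ φ h = ∑-mono λ x → ▸-mono (lookup S x xor b) (h x ∘ xor-true (lookup S x) b)

  U-mono : ∀ φ ψ → (∀ x → lookup S x ≡ not b → φ (S [ x ]≔ b) ≤ ψ (S [ x ]≔ b)) → U b φ S ≤ U b ψ S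
  U-mono φ ψ = U-≤ φ

  U-cong : ∀ φ ψ → (∀ x → lookup S x ≡ not b → φ (S [ x ]≔ b) ≡ ψ (S [ x ]≔ b)) → U b φ S ≡ U b ψ S
  U-cong φ ψ h = sum-cong-≗ λ x → ▸-cong (lookup S x xor b) (h x ∘ xor-true (lookup S x) b)

  rem-* : ∀ c → ∑[ x < n ] ((lookup S x xor b) ▸ c) ≡ c * rem b S
  rem-* = ∑-▸ (λ x → lookup S x xor b)

  U-≤-const : ∀ φ {c} → (∀ x → lookup S x ≡ not b → φ (S [ x ]≔ b) ≤ c) → U b φ S ≤ c * rem b S
  U-≤-const φ {c} h = ≤-trans (U-≤ φ h) (≤-reflexive (rem-* c))

  U-+ : ∀ φ ψ → U b (λ T → φ T + ψ T) S ≡ U b φ S + U b ψ S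
  U-+ φ ψ = trans (sum-cong-≗ λ x → ▸-+ (lookup S x xor b) (φ (S [ x ]≔ b)) (ψ (S [ x ]≔ b)))
    (∑-distrib-+ (λ x → (lookup S x xor b) ▸ φ (S [ x ]≔ b)) (λ x → (lookup S x xor b) ▸ ψ (S [ x ]≔ b)))

  U-positive : ∀ φ → 0 < U b φ S → ∃[ x ] lookup S x ≡ not b × 0 < φ (S [ x ]≔ b)
  U-positive φ h = let x , p = ∑-<-witness (subst (_< U b φ S) (sym (trans (∑-const n 0) (*-zeroʳ n))) h) in
    x , ungate (lookup S x) p
    where
    ungate : ∀ {v} c → 0 < (c xor b) ▸ v → c ≡ not b × 0 < v
    ungate c p with c xor b in eq
    ... | true = xor-true c b eq , p

rem-step : ∀ b (S : Subset n) x → lookup S x ≡ not b → suc (rem b (S [ x ]≔ b)) ≡ rem b S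
rem-step b (s ∷ S) zero    refl rewrite xor-same b | not-xor b = refl
rem-step b (s ∷ S) (suc x) eq   =
  trans (sym (+-suc ((s xor b) ▸ 1) _)) (cong ((s xor b) ▸ 1 +_) (rem-step b S x eq))

rem-complement : (S : Subset n) → rem true S + rem false S ≡ n
rem-complement []          = refl
rem-complement (true ∷ S)  = trans (+-suc _ _) (cong suc (rem-complement S))
rem-complement (false ∷ S) = cong suc (rem-complement S)

rem-false : (S : Subset n) → rem false S ≡ ∣ S ∣
rem-false []          = refl
rem-false (true ∷ S)  = cong suc (rem-false S)
rem-false (false ∷ S) = rem-false S

-- Induction along chains: each switch to `b` lowers `rem b`, which serves as the measure.
rem-ind : ∀ b (P : Subset n → Set) →
          (∀ S → (∀ x → lookup S x ≡ not b → P (S [ x ]≔ b)) → P S) → ∀ S → P S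
rem-ind {n} b P step S = go (rem b S) S ≤-refl
  where
  go : ∀ m S → rem b S ≤ m → P S
  go m S h = step S λ x eq → descend m x eq (subst (_≤ m) (sym (rem-step b S x eq)) h)
    where
    descend : ∀ m x → lookup S x ≡ not b → suc (rem b (S [ x ]≔ b)) ≤ m → P (S [ x ]≔ b)
    descend (suc m) x eq (s≤s h) = go m (S [ x ]≔ b) h

-- T arises from S by switching coordinates to b: ⊆ for b = true, ⊇ for b = false.
_⊑[_]_ : Subset n → Bool → Subset n → Set
S ⊑[ b ] T = ∀ x → lookup S x ≡ b → lookup T x ≡ b

⊑-refl : ∀ {b} (S : Subset n) → S ⊑[ b ] S
⊑-refl S x eq = eq

⊑-trans : ∀ {b} (S T R : Subset n) → S ⊑[ b ] T → T ⊑[ b ] R → S ⊑[ b ] R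
⊑-trans S T R p q x eq = q x (p x eq)

_⊑?[_]_ : (S : Subset n) → ∀ b T → Dec (S ⊑[ b ] T)
S ⊑?[ b ] T = all? λ x → (lookup S x Bool.≟ b) →-dec (lookup T x Bool.≟ b)

flip-⊑ : ∀ b (S : Subset n) x → S ⊑[ b ] (S [ x ]≔ b)
flip-⊑ b S x y eq with y Fin.≟ x
... | yes refl = lookup∘update x S b
... | no y≢x   = trans (lookup∘update′ y≢x S b) eq

⊑-reverse : ∀ {b} (S T : Subset n) → S ⊑[ b ] T → T ⊑[ not b ] S
⊑-reverse {b = b} S T p x eq with lookup S x Bool.≟ not b
... | yes q = q
... | no q  = contradiction (trans (sym eq) (p x (trans (¬-not q) (not-involutive b)))) (not-¬ refl ∘ sym)

-- Double counting of the pairs that differ in one coordinate: `f₁ S * g₀ S` is the pair differing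
-- in the first one, and all other pairs fall to the induction hypothesis.
U-adjoint : (f g : Subset n → ℕ) → ∑S (λ S → g S * U true f S) ≡ ∑S (λ T → f T * U false g T)
U-adjoint {zero}  f g = trans (*-zeroʳ (g [])) (sym (*-zeroʳ (f [])))
U-adjoint {suc n} f g = begin
  ∑S (λ S → g₀ S * (f₁ S + U true f₀ S)) + ∑S (λ S → g₁ S * U true f₁ S)
    ≡⟨ cong (_+ ∑S (λ S → g₁ S * U true f₁ S)) (trans (∑S-cong λ S → *-distribˡ-+ (g₀ S) _ _) (∑S-+ (λ S → g₀ S * f₁ S) _)) ⟩
  (∑S (λ S → g₀ S * f₁ S) + ∑S (λ S → g₀ S * U true f₀ S)) + ∑S (λ S → g₁ S * U true f₁ S)
    ≡⟨ cong₂ _+_ (cong₂ _+_ (∑S-cong λ S → *-comm (g₀ S) (f₁ S)) (U-adjoint f₀ g₀)) (U-adjoint f₁ g₁) ⟩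
  (∑S (λ S → f₁ S * g₀ S) + ∑S (λ S → f₀ S * U false g₀ S)) + ∑S (λ S → f₁ S * U false g₁ S)
    ≡⟨ rotate (∑S (λ S → f₁ S * g₀ S)) _ _ ⟩
  ∑S (λ S → f₀ S * U false g₀ S) + (∑S (λ S → f₁ S * g₀ S) + ∑S (λ S → f₁ S * U false g₁ S))
    ≡⟨ cong (∑S (λ S → f₀ S * U false g₀ S) +_) (trans (∑S-cong λ S → *-distribˡ-+ (f₁ S) _ _) (∑S-+ (λ S → f₁ S * g₀ S) _)) ⟨
  ∑S (λ S → f₀ S * U false g₀ S) + ∑S (λ S → f₁ S * (g₀ S + U false g₁ S)) ∎
  where
  open ≡-Reasoning
  f₀ f₁ g₀ g₁ : Subset n → ℕ
  f₀ = f ∘ (false ∷_)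
  f₁ = f ∘ (true ∷_)
  g₀ = g ∘ (false ∷_)
  g₁ = g ∘ (true ∷_)
  rotate : ∀ a b c → (a + b) + c ≡ b + (a + c)
  rotate = solve-∀

-- Chains and their first member of the family

gate-split : ∀ c (v : ℕ) → v ≡ c ▸ v + not c ▸ v
gate-split true  v = sym (+-identityʳ v)
gate-split false v = refl

∑S-bottom : ∀ c → ∑S {n} (λ S → (rem false S ≡ᵇ 0) ▸ c) ≡ c
∑S-bottom {zero}  c = refl
∑S-bottom {suc n} c = trans (cong₂ _+_ (∑S-bottom {n} c) (∑S-zero n)) (+-identityʳ c)

rem-mono : ∀ b (S T : Subset n) → S ⊑[ b ] T → rem b T ≤ rem b S
rem-mono {n} b S T le = ∑-mono λ x → weaken (lookup S x) (lookup T x) (le x)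
  where
  weaken : ∀ c d → (c ≡ b → d ≡ b) → (d xor b) ▸ 1 ≤ (c xor b) ▸ 1
  weaken c d h with c xor b in eq
  ... | true  = ▸-≤ (d xor b) 1
  ... | false rewrite h (xor-false c b eq) | xor-same b = z≤n

module FirstHit {n} (fam : Subset n → Bool) where

  private variable
    b : Bool
    S T : Subset n
    f g : Subset n → ℕ

  -- Weighted count of the chains leaving S in direction b: a chain counts f T for the
  -- first member T of the family on it (S included); m is the number of remaining steps.
  hit : Bool → ℕ → (Subset n → ℕ) → Subset n → ℕ
  hit b zero    f S = if fam S then f S * 1 else 0
  hit b (suc m) f S = if fam S then f S * suc m ! else U b (hit b m f) S

  -- The fuel is exact, so `val b f S / rem b S !` is the mean of `f` at the first member on a
  -- random chain from S, chains without a member counting 0.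
  val : Bool → (Subset n → ℕ) → Subset n → ℕ
  val b f S = hit b (rem b S) f S

  -- At least one switch is made, so a member S does not find itself; this is the version for
  -- consecutive members.
  H : Bool → (Subset n → ℕ) → Subset n → ℕ
  H b f S = U b (val b f) S

  val-member : fam S ≡ true → val b f S ≡ f S * rem b S !
  val-member {S} {b} eq with rem b S
  ... | zero  rewrite eq = refl
  ... | suc m rewrite eq = refl

  val-skip : fam S ≡ false → val b f S ≡ H b f S
  val-skip {S} {b} {f} eq = go (rem b S) refl
    where
    go : ∀ m → rem b S ≡ m → hit b m f S ≡ H b f S
    go zero    r rewrite eq = sym (n≤0⇒n≡0 (subst (H b f S ≤_) r
      (≤-trans (U-≤-const {b = b} {S} (val b f) {0} λ x ex → contradiction (trans (rem-step b S x ex) r) λ ()) z≤n)))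
    go (suc m) r rewrite eq = U-cong {b = b} {S} (hit b m f) (val b f) λ x ex →
      cong (λ m → hit b m f (S [ x ]≔ b)) (suc-injective (trans (sym r) (sym (rem-step b S x ex))))

  val-witness : 0 < val b f S → ∃[ T ] S ⊑[ b ] T × fam T ≡ true × 0 < f T
  H-witness : 0 < H b f S → ∃[ T ] S ⊑[ b ] T × rem b T < rem b S × fam T ≡ true × 0 < f T

  val-witness {b} {f} {S} = rem-ind b (λ S → 0 < val b f S → ∃[ T ] S ⊑[ b ] T × fam T ≡ true × 0 < f T) step S
    where
    step : ∀ S → (∀ x → lookup S x ≡ not b → 0 < val b f (S [ x ]≔ b) → ∃[ T ] (S [ x ]≔ b) ⊑[ b ] T × fam T ≡ true × 0 < f T) → 0 < val b f S → ∃[ T ] S ⊑[ b ] T × fam T ≡ true × 0 < f T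
    step S ih p with fam S in eq
    ... | true  = S , ⊑-refl S , eq , positive (f S) (subst (0 <_) (val-member {S} {b} {f} eq) p)
      where
      positive : ∀ v → 0 < v * rem b S ! → 0 < v
      positive (suc v) _ = s≤s z≤n
    ... | false = let x , ex , q = U-positive {b = b} {S} (val b f) (subst (0 <_) (val-skip {S} {b} {f} eq) p)
                      T , le , rest = ih x ex q
                  in T , ⊑-trans S (S [ x ]≔ b) T (flip-⊑ b S x) le , rest

  H-witness {b} {f} {S} p =
    let x , ex , q = U-positive {b = b} {S} (val b f) p
        T , le , rest = val-witness q
    in T , ⊑-trans S (S [ x ]≔ b) T (flip-⊑ b S x) le ,
       subst (rem b T <_) (rem-step b S x ex) (s≤s (rem-mono b (S [ x ]≔ b) T le)) , rest

  val-mono : (∀ T → fam T ≡ true → f T ≤ g T) → ∀ S → val b f S ≤ val b g S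
  val-mono {f} {g} {b} h = rem-ind b (λ S → val b f S ≤ val b g S) step
    where
    step : ∀ S → (∀ x → lookup S x ≡ not b → val b f (S [ x ]≔ b) ≤ val b g (S [ x ]≔ b)) → val b f S ≤ val b g S
    step S ih with fam S in eq
    ... | true  = subst₂ _≤_ (sym (val-member {S} {b} eq)) (sym (val-member {S} {b} eq)) (*-monoˡ-≤ (rem b S !) (h S eq))
    ... | false = subst₂ _≤_ (sym (val-skip {S} {b} eq)) (sym (val-skip {S} {b} eq)) (U-mono {b = b} {S} (val b f) (val b g) ih)

  H-mono : (∀ T → fam T ≡ true → f T ≤ g T) → ∀ S → H b f S ≤ H b g S
  H-mono {f} {g} {b} h S = U-mono {b = b} {S} (val b f) (val b g) λ x _ → val-mono h (S [ x ]≔ b)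

  val-+ : ∀ f g S → val b (λ T → f T + g T) S ≡ val b f S + val b g S
  val-+ {b} f g = rem-ind b (λ S → val b f+g S ≡ val b f S + val b g S) step
    where
    f+g : Subset n → ℕ
    f+g T = f T + g T
    step : ∀ S → (∀ x → lookup S x ≡ not b → val b f+g (S [ x ]≔ b) ≡ val b f (S [ x ]≔ b) + val b g (S [ x ]≔ b)) → val b f+g S ≡ val b f S + val b g S
    step S ih with fam S in eq
    ... | true  = trans (val-member {S} {b} eq) (trans (*-distribʳ-+ (rem b S !) (f S) (g S))
                    (sym (cong₂ _+_ (val-member {S} {b} eq) (val-member {S} {b} eq))))
    ... | false = trans (val-skip {S} {b} eq) (trans (U-cong {b = b} {S} (val b f+g) (λ T → val b f T + val b g T) ih)
                    (trans (U-+ {b = b} {S} (val b f) (val b g))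
                    (sym (cong₂ _+_ (val-skip {S} {b} eq) (val-skip {S} {b} eq)))))

  H-+ : ∀ f g S → H b (λ T → f T + g T) S ≡ H b f S + H b g S
  H-+ {b} f g S = trans (U-cong {b = b} {S} (val b (λ T → f T + g T)) (λ T → val b f T + val b g T) λ x _ → val-+ f g (S [ x ]≔ b)) (U-+ {b = b} {S} (val b f) (val b g))

  rem!-step : ∀ b (S : Subset n) {φ} → (∀ x → lookup S x ≡ not b → φ (S [ x ]≔ b) ≤ rem b (S [ x ]≔ b) !) → U b φ S ≤ rem b S !
  rem!-step b S {φ} h = go (rem b S) refl
    where
    go : ∀ m → rem b S ≡ m → U b φ S ≤ m !
    go zero r = ≤-trans (U-≤-const {b = b} {S} φ {0} λ x ex → contradiction (trans (rem-step b S x ex) r) λ ()) z≤n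
    go (suc m) r = ≤-trans (U-≤-const {b = b} {S} φ {m !} λ x ex →
      subst (λ k → φ (S [ x ]≔ b) ≤ k !) (suc-injective (trans (rem-step b S x ex) r)) (h x ex))
      (≤-reflexive (trans (cong (m ! *_) r) (*-comm (m !) (suc m))))

  val-≤-! : (∀ T → f T ≤ 1) → ∀ S → val b f S ≤ rem b S !
  val-≤-! {f} {b} h = rem-ind b (λ S → val b f S ≤ rem b S !) step
    where
    step : ∀ S → (∀ x → lookup S x ≡ not b → val b f (S [ x ]≔ b) ≤ rem b (S [ x ]≔ b) !) → val b f S ≤ rem b S !
    step S ih with fam S in eq
    ... | true  = subst₂ _≤_ (sym (val-member {S} {b} eq)) (*-identityˡ _) (*-monoˡ-≤ (rem b S !) (h S))
    ... | false = subst (_≤ rem b S !) (sym (val-skip {S} {b} eq)) (rem!-step b S {val b f} ih)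

  -- Chains through a pair of consecutive members can be counted from either end: U-adjoint
  -- says so for the sums over all subsets, and outside the family the two summands agree.
  H-duality : ∀ f g → ∑S (λ A → fam A ▸ g A * rem false A ! * H true f A)
                    ≡ ∑S (λ B → fam B ▸ f B * rem true B ! * H false g B)
  H-duality f g = +-cancelʳ-≡ (∑S (λ S → not (fam S) ▸ val false g S * val true f S)) _ _ (begin
    ∑S (λ A → fam A ▸ g A * rem false A ! * H true f A) + ∑S (λ S → not (fam S) ▸ val false g S * val true f S)
      ≡⟨ ∑S-+ (λ A → fam A ▸ g A * rem false A ! * H true f A) _ ⟨
    ∑S (λ S → fam S ▸ g S * rem false S ! * H true f S + not (fam S) ▸ val false g S * val true f S)
      ≡⟨ ∑S-cong (λ S → up S) ⟩
    ∑S (λ S → val false g S * H true f S)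
      ≡⟨ U-adjoint (val true f) (val false g) ⟩
    ∑S (λ S → val true f S * H false g S)
      ≡⟨ ∑S-cong (λ S → down S) ⟨
    ∑S (λ S → fam S ▸ f S * rem true S ! * H false g S + not (fam S) ▸ val false g S * val true f S)
      ≡⟨ ∑S-+ (λ B → fam B ▸ f B * rem true B ! * H false g B) _ ⟩
    ∑S (λ B → fam B ▸ f B * rem true B ! * H false g B) + ∑S (λ S → not (fam S) ▸ val false g S * val true f S) ∎)
    where
    open ≡-Reasoning
    up : ∀ S → fam S ▸ g S * rem false S ! * H true f S + not (fam S) ▸ val false g S * val true f S ≡ val false g S * H true f S
    up S with fam S in eq
    ... | true  = trans (+-identityʳ _) (cong (_* H true f S) (sym (val-member {S} {false} eq)))
    ... | false = cong (val false g S *_) (val-skip {S} {true} eq)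
    down : ∀ S → fam S ▸ f S * rem true S ! * H false g S + not (fam S) ▸ val false g S * val true f S ≡ val true f S * H false g S
    down S with fam S in eq
    ... | true  = trans (+-identityʳ _) (cong (_* H false g S) (sym (val-member {S} {true} eq)))
    ... | false = trans (*-comm (val false g S) _) (cong (val true f S *_) (val-skip {S} {false} eq))

  W : Subset n → ℕ
  W S = rem false S ! * rem true S !

  one : Subset n → ℕ
  one _ = 1

  -- A maximal chain meeting the family in X sets has at least X - 1 consecutive pairs.
  lubell : ∑S (λ A → fam A ▸ W A) ≤ ∑S (λ A → fam A ▸ rem false A ! * H true one A) + n !
  lubell = +-cancelʳ-≤ (∑S rest) _ _ (begin
    ∑S (λ S → fam S ▸ W S) + ∑S rest
      ≡⟨ ∑S-+ (λ S → fam S ▸ W S) rest ⟨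
    ∑S (λ S → fam S ▸ W S + rest S)
      ≡⟨ ∑S-cong left ⟩
    ∑S (λ S → u S * rem false S !)
      ≤⟨ ∑S-mono bottom ⟩
    ∑S (λ S → u S * U false (λ T → rem false T !) S + (rem false S ≡ᵇ 0) ▸ n !)
      ≡⟨ ∑S-+ {n} (λ S → u S * U false (λ T → rem false T !) S) (λ S → (rem false S ≡ᵇ 0) ▸ n !) ⟩
    ∑S (λ S → u S * U false (λ T → rem false T !) S) + ∑S {n} (λ S → (rem false S ≡ᵇ 0) ▸ n !)
      ≡⟨ cong₂ _+_ (sym (U-adjoint u (λ S → rem false S !))) (∑S-bottom {n} (n !)) ⟩
    ∑S (λ S → rem false S ! * U true u S) + n !
      ≡⟨ cong (_+ n !) (∑S-cong λ S → gate-split (fam S) (rem false S ! * U true u S)) ⟩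
    ∑S (λ S → fam S ▸ rem false S ! * H true one S + rest S) + n !
      ≡⟨ cong (_+ n !) (∑S-+ (λ S → fam S ▸ rem false S ! * H true one S) rest) ⟩
    (∑S (λ S → fam S ▸ rem false S ! * H true one S) + ∑S rest) + n !
      ≡⟨ swap-right (∑S (λ S → fam S ▸ rem false S ! * H true one S)) (∑S rest) (n !) ⟩
    (∑S (λ S → fam S ▸ rem false S ! * H true one S) + n !) + ∑S rest ∎)
    where
    open ≤-Reasoning
    u rest : Subset n → ℕ
    u = val true one
    rest S = not (fam S) ▸ rem false S ! * H true one S
    swap-right : ∀ a b c → (a + b) + c ≡ (a + c) + b
    swap-right = solve-∀
    left : ∀ S → fam S ▸ W S + rest S ≡ u S * rem false S !
    left S with fam S in eq
    ... | true  = trans (+-identityʳ _) (trans (*-comm (rem false S !) _)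
                    (cong (_* rem false S !) (sym (trans (val-member {S} {true} eq) (*-identityˡ _)))))
    ... | false = trans (*-comm (rem false S !) _) (cong (_* rem false S !) (sym (val-skip {S} {true} eq)))
    -- A chain down from a nonempty S passes through exactly one cocover. Only the empty set has
    -- none, and its term, at most `n !`, is where the summand `n !` comes from.
    bottom : ∀ S → u S * rem false S ! ≤ u S * U false (λ T → rem false T !) S + (rem false S ≡ᵇ 0) ▸ n !
    bottom S with rem false S in eq
    ... | zero  = ≤-trans (≤-reflexive (*-identityʳ (u S))) (≤-trans (val-≤-! {one} {true} (λ _ → ≤-refl) S)
                    (≤-trans (≤-reflexive (cong _! (trans (sym (+-identityʳ _)) (trans (cong (rem true S +_) (sym eq)) (rem-complement S))))) (m≤n+m _ _)))
    ... | suc m = ≤-trans (≤-reflexive (cong (u S *_) (begin-equality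
        suc m * m !
          ≡⟨ cong (_* m !) eq ⟨
        rem false S * m !
          ≡⟨ *-comm _ (m !) ⟩
        m ! * rem false S
          ≡⟨ rem-* {b = false} {S} (m !) ⟨
        U false (λ _ → m !) S
          ≡⟨ U-cong {b = false} {S} (λ _ → m !) (λ T → rem false T !)
               (λ x ex → cong _! (suc-injective (trans (sym eq) (sym (rem-step false S x ex))))) ⟩
        U false (λ T → rem false T !) S ∎))) (m≤m+n _ _)

-- Random chains avoid rare events

differs : Fin n → Bool → Subset n → ℕ
differs x y T = (lookup T x xor y) ▸ 1

below : Bool → Subset n → Subset n → ℕ
below b D T = does (T ⊑?[ b ] D) ▸ 1

differs-zero : ∀ (x : Fin n) y T → differs x y T ≡ 0 → lookup T x ≡ y
differs-zero x y T h with lookup T x xor y in eq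
... | false = xor-false (lookup T x) y eq

below-positive : ∀ b (D T : Subset n) → 0 < below b D T → T ⊑[ b ] D
below-positive b D T = positive (T ⊑?[ b ] D)
  where
  positive : ∀ {P : Set} (d : Dec P) → 0 < does d ▸ 1 → P
  positive (yes p) _ = p

below-zero : ∀ b (D T : Subset n) → below b D T ≡ 0 → ¬ (T ⊑[ b ] D)
below-zero b D T = zeroed (T ⊑?[ b ] D)
  where
  zeroed : ∀ {P : Set} (d : Dec P) → does d ▸ 1 ≡ 0 → ¬ P
  zeroed (no ¬p) _ = ¬p

module Spread {n} (fam : Subset n → Bool) (lo s : ℕ)
  (lower : ∀ b T → fam T ≡ true → lo ≤ rem b T)
  (upper : ∀ b T → fam T ≡ true → rem b T ≤ lo + s) where

  open FirstHit fam

  -- Every later set has fewer than `lo` switches left, too few for a member.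
  H-zero : ∀ b f S → rem b S ≤ lo → H b f S ≡ 0
  H-zero b f S le with H b f S in eq
  ... | zero  = refl
  ... | suc _ = let T , _ , lt , t , _ = H-witness {b} {f} {S} (subst (0 <_) (sym eq) (s≤s z≤n))
                in contradiction (≤-trans lt le) (≤⇒≯ (lower b T t))

  -- A random chain switches the coordinate x during its first rem S - lo steps with
  -- probability at most (rem S - lo) / lo.
  H-differs : ∀ b x y S → lookup S x ≡ y → lo * H b (differs x y) S ≤ (rem b S ∸ lo) * rem b S !
  H-differs b x y = rem-ind b P step
    where
    δ : Subset n → ℕ
    δ = differs x y
    P : Subset n → Set
    P S = lookup S x ≡ y → lo * H b δ S ≤ (rem b S ∸ lo) * rem b S !

    step : ∀ S → (∀ z → lookup S z ≡ not b → P (S [ z ]≔ b)) → P S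
    step S ih ex = go (rem b S) refl
      where
      open ≤-Reasoning
      easy : rem b S ≤ lo → lo * H b δ S ≤ (rem b S ∸ lo) * rem b S !
      easy le = ≤-trans (≤-reflexive (trans (cong (lo *_) (H-zero b δ S le)) (*-zeroʳ lo))) z≤n

      go : ∀ m → rem b S ≡ m → lo * H b δ S ≤ (rem b S ∸ lo) * rem b S !
      go zero    r = easy (≤-trans (≤-reflexive r) z≤n)
      go (suc m) r with lo ≤? m
      ... | no  lo≰m = easy (≤-trans (≤-reflexive r) (≰⇒> lo≰m))
      ... | yes lo≤m = begin
        lo * H b δ S
          ≡⟨ *-distribˡ-sum lo (λ z → (lookup S z xor b) ▸ val b δ (S [ z ]≔ b)) ⟩
        ∑[ z < n ] (lo * ((lookup S z xor b) ▸ val b δ (S [ z ]≔ b)))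
          ≡⟨ sum-cong-≗ (λ z → ▸-*ˡ (lookup S z xor b) lo _) ⟩
        U b (λ T → lo * val b δ T) S
          ≤⟨ U-≤ {b = b} {S} (λ T → lo * val b δ T) each ⟩
        ∑[ z < n ] ((lookup S z xor b) ▸ (c + does (z Fin.≟ x) ▸ lo * m !))
          ≤⟨ ∑-mono (λ z → ≤-trans (≤-reflexive (▸-+ (lookup S z xor b) c _)) (+-monoʳ-≤ _ (▸-≤ (lookup S z xor b) _))) ⟩
        ∑[ z < n ] ((lookup S z xor b) ▸ c + does (z Fin.≟ x) ▸ lo * m !)
          ≡⟨ ∑-distrib-+ (λ z → (lookup S z xor b) ▸ c) (λ z → does (z Fin.≟ x) ▸ lo * m !) ⟩
        ∑[ z < n ] ((lookup S z xor b) ▸ c) + ∑[ z < n ] (does (z Fin.≟ x) ▸ lo * m !)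
          ≡⟨ cong₂ _+_ (rem-* {b = b} {S} c) (∑-indicator x (lo * m !)) ⟩
        c * rem b S + lo * m !
          ≡⟨ cong (λ k → c * k + lo * m !) r ⟩
        c * suc m + lo * m !
          -- A first switch at x has probability 1 / (m + 1), which `lo` scales to at most 1; the
          -- other first switches carry the induction bound m - lo.
          ≤⟨ +-monoʳ-≤ (c * suc m) (*-monoˡ-≤ (m !) (m≤n⇒m≤1+n lo≤m)) ⟩
        c * suc m + suc m * m !
          ≡⟨ collect (m ∸ lo) (m !) (suc m) ⟩
        suc (m ∸ lo) * suc m !
          ≡⟨ cong₂ _*_ (sym (+-∸-assoc 1 lo≤m)) refl ⟩
        (suc m ∸ lo) * suc m !
          ≡⟨ cong (λ k → (k ∸ lo) * k !) r ⟨
        (rem b S ∸ lo) * rem b S ! ∎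
        where
        c : ℕ
        c = (m ∸ lo) * m !
        collect : ∀ a f k → (a * f) * k + k * f ≡ suc a * (k * f)
        collect = solve-∀
        rem-next : ∀ z → lookup S z ≡ not b → rem b (S [ z ]≔ b) ≡ m
        rem-next z ez = suc-injective (trans (rem-step b S z ez) r)
        each : ∀ z → lookup S z ≡ not b → lo * val b δ (S [ z ]≔ b) ≤ c + does (z Fin.≟ x) ▸ lo * m !
        each z ez with z Fin.≟ x
        ... | yes _ = ≤-trans (*-monoʳ-≤ lo (≤-trans (val-≤-! {δ} {b} (λ T → ▸-≤ (lookup T x xor y) 1) (S [ z ]≔ b)) (≤-reflexive (cong _! (rem-next z ez))))) (m≤n+m _ c)
        ... | no z≢x = ≤-trans (rest (fam (S [ z ]≔ b)) refl) (≤-reflexive (sym (+-identityʳ c)))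
          where
          ex′ : lookup (S [ z ]≔ b) x ≡ y
          ex′ = trans (lookup∘update′ (z≢x ∘ sym) S b) ex
          rest : ∀ v → fam (S [ z ]≔ b) ≡ v → lo * val b δ (S [ z ]≔ b) ≤ c
          rest true  t = ≤-trans (≤-reflexive (trans (cong (lo *_) (trans (val-member {S [ z ]≔ b} {b} t)
            (cong (λ v → (v ▸ 1) * rem b (S [ z ]≔ b) !) (trans (cong (_xor y) ex′) (xor-same y))))) (*-zeroʳ lo))) z≤n
          rest false t = subst₂ _≤_ (cong (lo *_) (sym (val-skip {S [ z ]≔ b} {b} t))) (cong (λ k → (k ∸ lo) * k !) (rem-next z ez)) (ih z ez ex′)

  -- To stay below D, the very first switch has to happen inside D.
  H-below : ∀ b S D → fam D ≡ true → S ⊑[ b ] D → lo ≤ rem b S → rem b S ≤ lo + s →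
            lo * H b (below b D) S ≤ s * rem b S !
  H-below b S D d le lo≤ ≤lo+s = go (rem b S) refl
    where
    open ≤-Reasoning
    go : ∀ m → rem b S ≡ m → lo * H b (below b D) S ≤ s * rem b S !
    go zero    r = ≤-trans (≤-reflexive (trans (cong (lo *_) (H-zero b (below b D) S (≤-trans (≤-reflexive r) z≤n))) (*-zeroʳ lo))) z≤n
    go (suc m) r = begin
      lo * H b (below b D) S ≤⟨ *-monoʳ-≤ lo (+-cancelʳ-≤ (m ! * rem b D) _ _ bound) ⟩
      lo * (m ! * s)         ≤⟨ *-monoˡ-≤ (m ! * s) (≤-trans lo≤ (≤-reflexive r)) ⟩
      suc m * (m ! * s)      ≡⟨ shuffle (suc m) (m !) s ⟩
      s * suc m !            ≡⟨ cong (λ k → s * k !) r ⟨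
      s * rem b S !          ∎
      where
      shuffle : ∀ a f t → a * (f * t) ≡ t * (a * f)
      shuffle = solve-∀
      each : ∀ x → lookup S x ≡ not b → val b (below b D) (S [ x ]≔ b) ≤ not (lookup D x xor b) ▸ m !
      each x ex with lookup D x xor b in eq
      ... | false = ≤-trans (val-≤-! {below b D} {b} (λ T → ▸-≤ (does (T ⊑?[ b ] D)) 1) (S [ x ]≔ b))
                      (≤-reflexive (cong _! (suc-injective (trans (rem-step b S x ex) r))))
      ... | true with val b (below b D) (S [ x ]≔ b) in pos
      ...   | zero  = z≤n
      ...   | suc _ =
        let T , leT , _ , q = val-witness {b} {below b D} {S [ x ]≔ b} (subst (0 <_) (sym pos) (s≤s z≤n))
            Dx = below-positive b D T q x (leT x (lookup∘update x S b))
        in contradiction (trans (sym (trans (cong (_xor b) Dx) (xor-same b))) eq) λ ()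
      disjoint : ∀ c e → (c ≡ b → e ≡ b) → (c xor b) ▸ (not (e xor b) ▸ m !) + (e xor b) ▸ m ! ≤ (c xor b) ▸ m !
      disjoint c e h with c xor b in eqc
      ... | false rewrite h (xor-false c b eqc) | xor-same b = z≤n
      ... | true with e xor b
      ...   | true  = ≤-refl
      ...   | false = ≤-reflexive (+-identityʳ _)
      -- The first switch may use `rem b S - rem b D` coordinates. That is at most s, since S has at
      -- most `lo + s` switches left and the member D at least `lo`.
      bound : H b (below b D) S + m ! * rem b D ≤ m ! * s + m ! * rem b D
      bound = begin
        H b (below b D) S + m ! * rem b D
          ≤⟨ +-mono-≤ (U-≤ {b = b} {S} (val b (below b D)) each) (≤-reflexive (sym (rem-* {b = b} {D} (m !)))) ⟩
        ∑[ x < n ] ((lookup S x xor b) ▸ (not (lookup D x xor b) ▸ m !)) + ∑[ x < n ] ((lookup D x xor b) ▸ m !)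
          ≡⟨ ∑-distrib-+ (λ x → (lookup S x xor b) ▸ (not (lookup D x xor b) ▸ m !)) (λ x → (lookup D x xor b) ▸ m !) ⟨
        ∑[ x < n ] ((lookup S x xor b) ▸ (not (lookup D x xor b) ▸ m !) + (lookup D x xor b) ▸ m !)
          ≤⟨ ∑-mono (λ x → disjoint (lookup S x) (lookup D x) (le x)) ⟩
        ∑[ x < n ] ((lookup S x xor b) ▸ m !)
          ≡⟨ rem-* {b = b} {S} (m !) ⟩
        m ! * rem b S
          ≤⟨ *-monoʳ-≤ (m !) (≤-trans ≤lo+s (≤-trans (≤-reflexive (+-comm lo s)) (+-monoʳ-≤ s (lower b D d)))) ⟩
        m ! * (s + rem b D)
          ≡⟨ *-distribˡ-+ (m !) s (rem b D) ⟩
        m ! * s + m ! * rem b D ∎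

  -- Union bound: each bad event g takes at most M from `lo * H b f S`. Restricting f to g = 0 loses
  -- no more than g, because f ≤ 1.
  avoid : ∀ b S M f (gs : List (Subset n → ℕ)) → (∀ T → f T ≤ 1) →
          All (λ g → lo * H b g S ≤ M) gs → length gs * M < lo * H b f S →
          ∃[ T ] S ⊑[ b ] T × fam T ≡ true × 0 < f T × All (λ g → g T ≡ 0) gs
  avoid b S M f [] f≤1 [] h with H b f S in eq
  ... | zero  = contradiction (subst (0 <_) (*-zeroʳ lo) h) λ ()
  ... | suc _ = let T , le , _ , t , p = H-witness {b} {f} {S} (subst (0 <_) (sym eq) (s≤s z≤n)) in T , le , t , p , []
  avoid b S M f (g ∷ gs) f≤1 (hg ∷ hgs) h =
    let T , le , t , p , ps = avoid b S M f′ gs f′≤1 hgs h′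
        p₁ , p₂ = split T p
    in T , le , t , p₂ , p₁ ∷ ps
    where
    open ≤-Reasoning
    f′ : Subset n → ℕ
    f′ T = (g T ≡ᵇ 0) ▸ f T
    f′≤1 : ∀ T → f′ T ≤ 1
    f′≤1 T = ≤-trans (▸-≤ (g T ≡ᵇ 0) (f T)) (f≤1 T)
    split : ∀ T → 0 < f′ T → g T ≡ 0 × 0 < f T
    split T p with g T
    ... | zero = refl , p
    cover : ∀ T → fam T ≡ true → f T ≤ f′ T + g T
    cover T _ with g T
    ... | zero  = m≤m+n _ _
    ... | suc _ = ≤-trans (f≤1 T) (s≤s z≤n)
    h′ : length gs * M < lo * H b f′ S
    h′ = +-cancelˡ-< M _ _ (begin-strict
      M + length gs * M           <⟨ h ⟩
      lo * H b f S                ≤⟨ *-monoʳ-≤ lo (≤-trans (H-mono cover S) (≤-reflexive (H-+ f′ g S))) ⟩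
      lo * (H b f′ S + H b g S)   ≡⟨ *-distribˡ-+ lo (H b f′ S) (H b g S) ⟩
      lo * H b f′ S + lo * H b g S ≤⟨ +-monoʳ-≤ (lo * H b f′ S) hg ⟩
      lo * H b f′ S + M           ≡⟨ +-comm _ M ⟩
      M + lo * H b f′ S           ∎)

  H-differs′ : ∀ b x S → rem b S ≤ lo + s → lo * H b (differs x (lookup S x)) S ≤ s * rem b S !
  H-differs′ b x S le = ≤-trans (H-differs b x (lookup S x) S refl)
    (*-monoˡ-≤ (rem b S !) (≤-trans (∸-monoˡ-≤ lo le) (≤-reflexive (m+n∸m≡n lo s))))

  -- With M = `rem b S !` and h / M at least 1 / D, K events of probability s / lo each cannot
  -- exhaust h; this is the last hypothesis of `avoid`.
  dense : ∀ {h} K D M → M ≤ D * h → D * K * s < lo → 0 < M → K * (s * M) < lo * h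
  dense {h} K D M hM small (s≤s z≤n) = *-cancelˡ-< D _ _ (begin-strict
    D * (K * (s * M)) ≡⟨ reassoc D K s M ⟩
    (D * K * s) * M   <⟨ *-monoˡ-< M small ⟩
    lo * M            ≤⟨ *-monoʳ-≤ lo hM ⟩
    lo * (D * h)      ≡⟨ swap lo D h ⟩
    D * (lo * h)      ∎)
    where
    open ≤-Reasoning
    reassoc : ∀ a b c d → a * (b * (c * d)) ≡ (a * b * c) * d
    reassoc = solve-∀
    swap : ∀ a b c → a * (b * c) ≡ b * (a * c)
    swap = solve-∀

  -- D and T lie on the same side of u, so `below b D` is the event that the chain fails to leave D;
  -- avoiding it yields z. The other events protect the coordinates in X.
  move-on : ∀ b D u X f d → (∀ T → f T ≤ 1) → fam u ≡ true → fam D ≡ true → u ⊑[ b ] D →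
            rem b u ! ≤ d * H b f u → d * suc (length X) * s < lo →
            ∃[ T ] u ⊑[ b ] T × fam T ≡ true × 0 < f T × All (λ x → lookup T x ≡ lookup u x) X ×
              ∃[ z ] lookup D z ≡ not b × lookup T z ≡ b
  move-on b D u X f d f≤1 u∈ D∈ le deg small =
    let T , leT , t , p , qs = avoid b u (s * rem b u !) f (below b D ∷ map (λ x → differs x (lookup u x)) X) f≤1
           (H-below b u D D∈ le (lower b u u∈) (upper b u u∈) ∷ All.map⁺ (universal (λ x → H-differs′ b x u (upper b u u∈)) X))
           (dense (suc (length (map (λ x → differs x (lookup u x)) X))) d (rem b u !) deg
             (subst (λ k → d * suc k * s < lo) (sym (length-map _ X)) small) (1≤n! (rem b u)))
    in T , leT , t , p , All.map (λ {x} → differs-zero x (lookup u x) T) (All.map⁻ (All.tail qs)) ,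
       escape T (below-zero b D T (All.head qs))
    where
    escape : ∀ T → ¬ (T ⊑[ b ] D) → ∃[ z ] lookup D z ≡ not b × lookup T z ≡ b
    escape T T⋢D with ¬∀⟶∃¬ n _ (λ x → (lookup T x Bool.≟ b) →-dec (lookup D x Bool.≟ b)) T⋢D
    ... | z , h with lookup T z Bool.≟ b
    ...   | no  t≢ = contradiction (λ t≡ → contradiction t≡ t≢) h
    ...   | yes t≡ = z , ¬-not (λ d≡ → h λ _ → d≡) , t≡

  -- `val` instead of `H`: S is the set just after a forced switch, and if it happens to be a
  -- member, the chain stops there.
  end-at : ∀ b S X d → rem b S ≤ lo + s → rem b S ! ≤ d * val b one S → d * length X * s < lo →
           ∃[ T ] S ⊑[ b ] T × fam T ≡ true × All (λ x → lookup T x ≡ lookup S x) X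
  end-at b S X d ≤lo+s deg small = go (fam S) refl
    where
    go : ∀ v → fam S ≡ v → ∃[ T ] S ⊑[ b ] T × fam T ≡ true × All (λ x → lookup T x ≡ lookup S x) X
    go true  t = S , ⊑-refl S , t , universal {P = λ x → lookup S x ≡ lookup S x} (λ _ → refl) X
    go false t =
      let T , leT , t′ , _ , qs = avoid b S (s * rem b S !) one (map (λ x → differs x (lookup S x)) X) (λ _ → ≤-refl)
            (All.map⁺ (universal (λ x → H-differs′ b x S ≤lo+s) X))
            (dense (length (map (λ x → differs x (lookup S x)) X)) d (rem b S !)
              (≤-trans deg (≤-reflexive (cong (d *_) (val-skip {S} {b} t))))
              (subst (λ k → d * k * s < lo) (sym (length-map _ X)) small) (1≤n! (rem b S)))
      in T , leT , t′ , All.map (λ {x} → differs-zero x (lookup S x) T) (All.map⁻ qs)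

-- Deleting members of low degree

_≟S_ : (S T : Subset n) → Dec (S ≡ T)
_≟S_ = ≡-dec Bool._≟_

∑S-indicator : ∀ (S : Subset n) (φ : Subset n → ℕ) → ∑S (λ T → does (T ≟S S) ▸ φ T) ≡ φ S
∑S-indicator []          φ = refl
∑S-indicator {suc n} (false ∷ S) φ = trans (cong₂ _+_ (∑S-indicator S (φ ∘ (false ∷_))) (∑S-zero n)) (+-identityʳ _)
∑S-indicator {suc n} (true ∷ S)  φ = cong₂ _+_ (∑S-zero n) (∑S-indicator S (φ ∘ (true ∷_)))

remove : Subset n → (Subset n → Bool) → Subset n → Bool
remove S a T = a T ∧ not (does (T ≟S S))

∑S-remove : ∀ (S : Subset n) a (φ : Subset n → ℕ) → a S ≡ true → ∑S (λ T → remove S a T ▸ φ T) + φ S ≡ ∑S (λ T → a T ▸ φ T)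
∑S-remove {n} S a φ aS = begin
  ∑S (λ T → remove S a T ▸ φ T) + φ S                              ≡⟨ cong (∑S (λ T → remove S a T ▸ φ T) +_) (∑S-indicator S φ) ⟨
  ∑S (λ T → remove S a T ▸ φ T) + ∑S (λ T → does (T ≟S S) ▸ φ T)   ≡⟨ ∑S-+ (λ T → remove S a T ▸ φ T) (λ T → does (T ≟S S) ▸ φ T) ⟨
  ∑S (λ T → remove S a T ▸ φ T + does (T ≟S S) ▸ φ T)              ≡⟨ ∑S-cong each ⟩
  ∑S (λ T → a T ▸ φ T)                                             ∎
  where
  open ≡-Reasoning
  each : ∀ T → remove S a T ▸ φ T + does (T ≟S S) ▸ φ T ≡ a T ▸ φ T
  each T with T ≟S S | a T in aT
  ... | yes refl | true  = refl
  ... | yes refl | false = contradiction (trans (sym aS) aT) λ ()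
  ... | no _     | true  = +-identityʳ _
  ... | no _     | false = refl

∧-trueˡ : ∀ {c d} → c ∧ d ≡ true → c ≡ true
∧-trueˡ {true} _ = refl

∧-trueʳ : ∀ {c d} → c ∧ d ≡ true → d ≡ true
∧-trueʳ {true} h = h

factor-positive : ∀ d {x y} → x < d * y → 0 < y
factor-positive d {y = zero}  h = contradiction (≤-trans h (≤-reflexive (*-zeroʳ d))) λ ()
factor-positive d {y = suc _} _ = s≤s z≤n

infix 4 _⊑_
_⊑_ : (a c : Subset n → Bool) → Set
a ⊑ c = ∀ S → a S ≡ true → c S ≡ true

module Cleaning {n} (fam : Subset n → Bool) where
  open FirstHit fam

  ind : (Subset n → Bool) → Subset n → ℕ
  ind a S = a S ▸ 1

  ind-≤1 : ∀ a S → ind a S ≤ 1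
  ind-≤1 a S = ▸-≤ (a S) 1

  -- Number of maximal chains with consecutive members in a and c, a being the side
  -- from which the chain leaves in direction b.
  mass : Bool → (a c : Subset n → Bool) → ℕ
  mass b a c = ∑S (λ S → a S ▸ rem (not b) S ! * H b (ind c) S)

  mass-dual : ∀ a c → a ⊑ fam → c ⊑ fam → mass true a c ≡ mass false c a
  mass-dual a c a⊑ c⊑ = trans (∑S-cong λ S → expand a a⊑ S (rem false S !) (H true (ind c) S))
    (trans (H-duality (ind c) (ind a)) (sym (∑S-cong λ S → expand c c⊑ S (rem true S !) (H false (ind a) S))))
    where
    expand : ∀ a → a ⊑ fam → ∀ S u v → a S ▸ u * v ≡ fam S ▸ ind a S * u * v
    expand a a⊑ S u v with a S in eq
    ... | false = sym (n≤0⇒n≡0 (▸-≤ (fam S) 0))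
    ... | true rewrite a⊑ S eq = cong (_* v) (sym (*-identityˡ u))

  weight : (Subset n → Bool) → ℕ
  weight a = ∑S (λ S → a S ▸ W S)

  size : (Subset n → Bool) → ℕ
  size a = ∑S (λ S → a S ▸ 1)

  Rich : ℕ → Bool → (a c : Subset n → Bool) → Set
  Rich D b a c = ∀ S → a S ≡ true → rem b S ! ≤ D * H b (ind c) S

  poor? : ∀ D b (a c : Subset n → Bool) → Dec (∃[ S ] a S ≡ true × D * H b (ind c) S < rem b S !)
  poor? D b a c = anySubset? λ S → (a S Bool.≟ true) ×-dec (D * H b (ind c) S <? rem b S !)

  rich : ∀ D b (a c : Subset n → Bool) → ¬ (∃[ S ] a S ≡ true × D * H b (ind c) S < rem b S !) → Rich D b a c
  rich D b a c none S aS = ≮⇒≥ λ lt → none (S , aS , lt)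

  -- Dropping a poor S lowers the left side by W S and the right side by less, so the inequality is
  -- an invariant of the deletions.
  remove-poor : ∀ D b S (a c : Subset n → Bool) Y → a S ≡ true → D * H b (ind c) S < rem b S ! → rem (not b) S ! * rem b S ! ≡ W S →
                weight a + Y < D * mass b a c → weight (remove S a) + Y < D * mass b (remove S a) c
  remove-poor D b S a c Y aS poor wS h = +-cancelʳ-< (W S) _ _ (begin-strict
    (weight (remove S a) + Y) + W S                 ≡⟨ swap-right (weight (remove S a)) Y (W S) ⟩
    (weight (remove S a) + W S) + Y                 ≡⟨ cong (_+ Y) (∑S-remove S a W aS) ⟩
    weight a + Y                                    <⟨ h ⟩
    D * mass b a c                                  ≡⟨ cong (D *_) (∑S-remove S a (λ S → rem (not b) S ! * H b (ind c) S) aS) ⟨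
    D * (mass b (remove S a) c + rem (not b) S ! * H b (ind c) S)
                                                    ≡⟨ distribute D (mass b (remove S a) c) (rem (not b) S !) (H b (ind c) S) ⟩
    D * mass b (remove S a) c + rem (not b) S ! * (D * H b (ind c) S)
                                                    ≤⟨ +-monoʳ-≤ (D * mass b (remove S a) c) (*-monoʳ-≤ (rem (not b) S !) (<⇒≤ poor)) ⟩
    D * mass b (remove S a) c + rem (not b) S ! * rem b S !
                                                    ≡⟨ cong (D * mass b (remove S a) c +_) wS ⟩
    D * mass b (remove S a) c + W S ∎)
    where
    open ≤-Reasoning
    swap-right : ∀ a b c → (a + b) + c ≡ (a + c) + b
    swap-right = solve-∀
    distribute : ∀ d m r h → d * (m + r * h) ≡ d * m + r * (d * h)
    distribute = solve-∀

  -- The invariant of `remove-poor`, with the total size as measure; its strictness is what leaves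
  -- positive mass when the deletions stop. `mass-dual` exchanges the roles of the two sides.
  clean : ∀ D a c → a ⊑ fam → c ⊑ fam → weight a + weight c < D * mass true a c →
          ∃[ a′ ] ∃[ c′ ] a′ ⊑ a × c′ ⊑ c × Rich D true a′ c′ × Rich D false c′ a′ × 0 < mass true a′ c′
  clean D a c a⊑ c⊑ h = go (size a + size c) a c a⊑ c⊑ ≤-refl h
    where
    smaller : ∀ S a {Y m} → a S ≡ true → size a + Y ≤ suc m → size (remove S a) + Y ≤ m
    smaller S a {Y} {m} aS h = ≤-pred (subst (_≤ suc m)
      (cong (_+ Y) (trans (sym (∑S-remove S a (λ _ → 1) aS)) (+-comm (size (remove S a)) 1))) h)
    inhabited : ∀ S a {m} → a S ≡ true → size a ≤ m → 0 < m
    inhabited S a aS h = ≤-trans (subst (λ v → v ▸ 1 ≤ size a) aS (term≤∑S (λ S → a S ▸ 1) S)) h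
    go : ∀ m a c → a ⊑ fam → c ⊑ fam → size a + size c ≤ m → weight a + weight c < D * mass true a c →
         ∃[ a′ ] ∃[ c′ ] a′ ⊑ a × c′ ⊑ c × Rich D true a′ c′ × Rich D false c′ a′ × 0 < mass true a′ c′
    go m a c a⊑ c⊑ sz h with poor? D true a c
    go zero a c a⊑ c⊑ sz h | yes (S , aS , _) = contradiction (inhabited S a aS (m+n≤o⇒m≤o _ sz)) λ ()
    go (suc m) a c a⊑ c⊑ sz h | yes (S , aS , poor) =
      let a′ , c′ , a′⊑ , rest = go m (remove S a) c (λ T p → a⊑ T (∧-trueˡ p)) c⊑ (smaller S a aS sz)
            (remove-poor D true S a c (weight c) aS poor refl h)
      in a′ , c′ , (λ T p → ∧-trueˡ (a′⊑ T p)) , rest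
    go m a c a⊑ c⊑ sz h | no rich₁ with poor? D false c a
    go zero a c a⊑ c⊑ sz h | no _ | yes (S , cS , _) = contradiction (inhabited S c cS (m+n≤o⇒n≤o (size a) sz)) λ ()
    go (suc m) a c a⊑ c⊑ sz h | no _ | yes (S , cS , poor) =
      let c⁻⊑ = λ T p → c⊑ T (∧-trueˡ p)
          a′ , c′ , a′⊑ , c′⊑ , rest = go m a (remove S c) a⊑ c⁻⊑
            (subst (_≤ m) (+-comm _ (size a)) (smaller S c cS (subst (_≤ suc m) (+-comm (size a) _) sz)))
            (subst₂ _<_ (+-comm _ (weight a)) (cong (D *_) (sym (mass-dual a (remove S c) a⊑ c⁻⊑)))
              (remove-poor D false S c a (weight a) cS poor (*-comm (rem true S !) _)
                (subst₂ _<_ (+-comm (weight a) _) (cong (D *_) (mass-dual a c a⊑ c⊑)) h)))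
      in a′ , c′ , a′⊑ , (λ T p → ∧-trueˡ (c′⊑ T p)) , rest
    go m a c a⊑ c⊑ sz h | no rich₁ | no rich₂ =
      a , c , (λ _ p → p) , (λ _ p → p) , rich D true a c rich₁ , rich D false c a rich₂ , factor-positive D h

-- Averaging over the element w

above-threshold : ∀ {a v c} (d : Dec (a ≤ v)) → v ≤ c → v ≤ does d ▸ c + a
above-threshold (yes _) v≤c = ≤-trans v≤c (m≤m+n _ _)
above-threshold (no ≰)  _   = <⇒≤ (≰⇒> ≰)

module Average {n} (fam : Subset n → Bool) (lo s N : ℕ)
  (lower : ∀ b T → fam T ≡ true → lo ≤ rem b T)
  (upper : ∀ b T → fam T ≡ true → rem b T ≤ lo + s)
  (lo>0 : 0 < lo) (N>0 : 0 < N) (n≤4lo : n ≤ 4 * lo) (narrow : 4 * N * s ≤ lo) where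

  open FirstHit fam
  open Spread fam lo s lower upper
  open Cleaning fam

  -- w is good for B if a random chain down from B starting with the removal of w
  -- meets the family again with probability at least 1 / 4N.
  good : Fin n → Subset n → Bool
  good w B = fam B ∧ (lookup B w ∧ does (rem false (B [ w ]≔ false) ! ≤? 4 * N * val false one (B [ w ]≔ false)))

  through : Fin n → Subset n → Bool
  through w A = fam A ∧ lookup A w

  private
    instance
      lo≢0 : NonZero lo
      lo≢0 = >-nonZero lo>0

  -- Light members, those under the threshold 1 / (2N), carry at most weight / (2N) of the pairs,
  -- half of what `weight≤pairs` guarantees. So only heavy ones need many good elements.
  module Heavy (B : Subset n) (B∈ : fam B ≡ true) (heavy : rem false B ! ≤ 2 * N * H false one B) where
    open ≤-Reasoning

    h r : ℕ
    h = H false one B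
    r = rem true B !

    -- A chain loses w with probability at most s / lo, hence at most 1 / (4N) by `narrow`;
    -- heaviness makes this at most half of the chains that meet the family.
    keep-half : ∀ w → lookup B w ≡ true → h ≤ 2 * H false (ind (through w)) B
    keep-half w Bw = +-cancelʳ-≤ h _ _ (begin
      h + h                   ≡⟨ cong (h +_) (+-identityʳ h) ⟨
      2 * h                   ≤⟨ *-monoʳ-≤ 2 (≤-trans (H-mono cover B) (≤-reflexive (H-+ (ind (through w)) δ B))) ⟩
      2 * (k + H false δ B)   ≡⟨ *-distribˡ-+ 2 k (H false δ B) ⟩
      2 * k + 2 * H false δ B ≤⟨ +-monoʳ-≤ (2 * k) few ⟩
      2 * k + h               ∎)
      where
      δ : Subset n → ℕ
      δ = differs w true
      k : ℕ
      k = H false (ind (through w)) B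
      cover : ∀ T → fam T ≡ true → 1 ≤ ind (through w) T + δ T
      cover T T∈ rewrite T∈ with lookup T w
      ... | true  = ≤-refl
      ... | false = ≤-refl
      regroup : ∀ a b c d → 2 * (a * (b * c * d)) ≡ 2 * b * c * a * d
      regroup = solve-∀
      few : 2 * H false δ B ≤ h
      few = *-cancelˡ-≤ lo (begin
        lo * (2 * H false δ B) ≡⟨ (λ a b → trans (sym (*-assoc a 2 b)) (trans (cong (_* b) (*-comm a 2)) (*-assoc 2 a b))) lo (H false δ B) ⟩
        2 * (lo * H false δ B) ≤⟨ *-monoʳ-≤ 2 (subst (λ y → lo * H false (differs w y) B ≤ s * rem false B !) Bw (H-differs′ false w B (upper false B B∈))) ⟩
        2 * (s * rem false B !) ≤⟨ *-monoʳ-≤ 2 (*-monoʳ-≤ s heavy) ⟩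
        2 * (s * (2 * N * h))   ≡⟨ regroup s 2 N h ⟩
        4 * N * s * h           ≤⟨ *-monoˡ-≤ h narrow ⟩
        lo * h                  ∎)

    goods : ℕ
    goods = ∑[ w < n ] (good w B ▸ 1)

    -- Reverse Markov: over the w in B, the probabilities of meeting the family after removing w
    -- average at least 1 / (2N). Elements that are not good contribute under 1 / (4N), so a share 1
    -- / (4N) of B is good, and B has at least n / 4 elements.
    many-good : n ≤ 16 * N * goods
    many-good = go (rem false B) refl (lower false B B∈)
      where
      go : ∀ m → rem false B ≡ m → lo ≤ m → n ≤ 16 * N * goods
      go zero    _ lo≤0 = contradiction (≤-trans lo>0 lo≤0) λ ()
      go (suc m) r lo≤ = begin
        n                  ≤⟨ n≤4lo ⟩
        4 * lo             ≤⟨ *-monoʳ-≤ 4 lo≤ ⟩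
        4 * suc m          ≤⟨ *-monoʳ-≤ 4 (*-cancelʳ-≤ (suc m) (4 * N * goods) (m !) {{m !≢0}} enough) ⟩
        4 * (4 * N * goods) ≡⟨ regroup N goods ⟩
        16 * N * goods     ∎
        where
        regroup : ∀ a b → 4 * (4 * a * b) ≡ 16 * a * b
        regroup = solve-∀
        next : ∀ w → lookup B w ≡ true → rem false (B [ w ]≔ false) ≡ m
        next w Bw = suc-injective (trans (rem-step false B w Bw) r)
        each : ∀ w → lookup B w ≡ true → 4 * N * val false one (B [ w ]≔ false) ≤ good w B ▸ 4 * N * m ! + m !
        each w Bw rewrite B∈ | Bw = ≤-trans
          (above-threshold (rem false (B [ w ]≔ false) ! ≤? 4 * N * val false one (B [ w ]≔ false))
            (*-monoʳ-≤ (4 * N) (≤-trans (val-≤-! {one} {false} (λ _ → ≤-refl) (B [ w ]≔ false)) (≤-reflexive (cong _! (next w Bw))))))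
          (+-monoʳ-≤ _ (≤-reflexive (cong _! (next w Bw))))
        split : 2 * (suc m * m !) ≤ 4 * N * m ! * goods + m ! * suc m
        split = begin
          2 * (suc m * m !)       ≤⟨ *-monoʳ-≤ 2 (subst (λ k → k ! ≤ 2 * N * h) r heavy) ⟩
          2 * (2 * N * h)         ≡⟨ trans (sym (*-assoc 2 (2 * N) h)) (cong (_* h) (sym (*-assoc 2 2 N))) ⟩
          4 * N * h               ≡⟨ *-distribˡ-sum (4 * N) (λ w → (lookup B w xor false) ▸ val false one (B [ w ]≔ false)) ⟩
          ∑[ w < n ] (4 * N * ((lookup B w xor false) ▸ val false one (B [ w ]≔ false)))
            ≡⟨ sum-cong-≗ (λ w → ▸-*ˡ (lookup B w xor false) (4 * N) _) ⟩
          U false (λ T → 4 * N * val false one T) B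
            ≤⟨ U-≤ {b = false} {B} (λ T → 4 * N * val false one T) each ⟩
          ∑[ w < n ] ((lookup B w xor false) ▸ (good w B ▸ 4 * N * m ! + m !))
            ≤⟨ ∑-mono (λ w → ≤-trans (≤-reflexive (▸-+ (lookup B w xor false) (good w B ▸ 4 * N * m !) (m !)))
                 (+-monoˡ-≤ _ (▸-≤ (lookup B w xor false) _))) ⟩
          ∑[ w < n ] (good w B ▸ 4 * N * m ! + (lookup B w xor false) ▸ m !)
            ≡⟨ ∑-distrib-+ (λ w → good w B ▸ 4 * N * m !) (λ w → (lookup B w xor false) ▸ m !) ⟩
          ∑[ w < n ] (good w B ▸ 4 * N * m !) + ∑[ w < n ] ((lookup B w xor false) ▸ m !)
            ≡⟨ cong₂ _+_ (∑-▸ (λ w → good w B) (4 * N * m !)) (trans (rem-* {b = false} {B} (m !)) (cong (m ! *_) r)) ⟩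
          4 * N * m ! * goods + m ! * suc m ∎
        double : ∀ a f → 2 * (a * f) ≡ a * f + f * a
        double = solve-∀
        move : ∀ a f g → a * f * g ≡ a * g * f
        move = solve-∀
        enough : suc m * m ! ≤ 4 * N * goods * m !
        enough = ≤-trans (+-cancelʳ-≤ (m ! * suc m) _ _ (subst (_≤ 4 * N * m ! * goods + m ! * suc m) (double (suc m) (m !)) split))
          (≤-reflexive (move (4 * N) (m !) goods))

    kept : goods * (r * h) ≤ 2 * ∑[ w < n ] (good w B ▸ r * H false (ind (through w)) B)
    kept = begin
      goods * (r * h)                  ≡⟨ *-comm goods (r * h) ⟩
      r * h * goods                    ≡⟨ ∑-▸ (λ w → good w B) (r * h) ⟨
      ∑[ w < n ] (good w B ▸ r * h)    ≤⟨ ∑-mono (λ w → ▸-mono (good w B) (λ gw → *-monoʳ-≤ r (keep-half w (∧-trueˡ (∧-trueʳ {fam B} gw))))) ⟩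
      ∑[ w < n ] (good w B ▸ r * (2 * H false (ind (through w)) B))
        ≡⟨ sum-cong-≗ (λ w → trans (cong (good w B ▸_) (swap r 2 _)) (sym (▸-*ˡ (good w B) 2 _))) ⟩
      ∑[ w < n ] (2 * (good w B ▸ r * H false (ind (through w)) B))
        ≡⟨ *-distribˡ-sum 2 (λ w → good w B ▸ r * H false (ind (through w)) B) ⟨
      2 * ∑[ w < n ] (good w B ▸ r * H false (ind (through w)) B) ∎
      where
      swap : ∀ a b c → a * (b * c) ≡ b * (a * c)
      swap = solve-∀

    heavy-bound : n * (2 * N) * (r * h) ≤ 64 * N * N * ∑[ w < n ] (good w B ▸ r * H false (ind (through w)) B)
    heavy-bound = begin
      n * (2 * N) * (r * h)                 ≤⟨ *-monoˡ-≤ (r * h) (*-monoˡ-≤ (2 * N) many-good) ⟩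
      16 * N * goods * (2 * N) * (r * h)    ≡⟨ regroup N goods (r * h) ⟩
      32 * N * N * (goods * (r * h))        ≤⟨ *-monoʳ-≤ (32 * N * N) kept ⟩
      32 * N * N * (2 * Σ)                  ≡⟨ regroup′ N Σ ⟩
      64 * N * N * Σ                        ∎
      where
      Σ : ℕ
      Σ = ∑[ w < n ] (good w B ▸ r * H false (ind (through w)) B)
      regroup : ∀ a b c → 16 * a * b * (2 * a) * c ≡ 32 * a * a * (b * c)
      regroup = solve-∀
      regroup′ : ∀ a b → 32 * a * a * (2 * b) ≡ 64 * a * a * b
      regroup′ = solve-∀

  top-bound : ∀ B → n * (2 * N) * (fam B ▸ rem true B ! * H false one B) ≤
    64 * N * N * ∑[ w < n ] (good w B ▸ rem true B ! * H false (ind (through w)) B) + n * (fam B ▸ W B)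
  top-bound B = go (fam B) refl
    where
    open ≤-Reasoning
    Σ : ℕ
    Σ = ∑[ w < n ] (good w B ▸ rem true B ! * H false (ind (through w)) B)
    regroup : ∀ a b c d → a * b * (c * d) ≡ a * (b * d * c)
    regroup = solve-∀
    go : ∀ v → fam B ≡ v → n * (2 * N) * (v ▸ rem true B ! * H false one B) ≤ 64 * N * N * Σ + n * (v ▸ W B)
    go false _ = ≤-trans (≤-reflexive (*-zeroʳ (n * (2 * N)))) z≤n
    go true B∈ with rem false B ! ≤? 2 * N * H false one B
    ... | yes heavy = ≤-trans (Heavy.heavy-bound B B∈ heavy) (m≤m+n _ _)
    ... | no  light = begin
      n * (2 * N) * (rem true B ! * H false one B)   ≡⟨ regroup n (2 * N) (rem true B !) (H false one B) ⟩
      n * (2 * N * H false one B * rem true B !)     ≤⟨ *-monoʳ-≤ n (*-monoˡ-≤ (rem true B !) (<⇒≤ (≰⇒> light))) ⟩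
      n * W B                                        ≤⟨ m≤n+m _ _ ⟩
      64 * N * N * Σ + n * W B                       ∎

  pairs : ℕ
  pairs = ∑S (λ B → fam B ▸ rem true B ! * H false one B)

  -- The excess and `lubell` give weight ≤ N * pairs. Summing `top-bound` over B and cancelling the
  -- light half leaves a lower bound for a sum over w, and some w reaches the mean.
  total : 0 < n → N * n ! + weight fam ≤ N * weight fam →
          ∃[ w ] weight (through w) + weight (good w) < 256 * N * N * mass true (through w) (good w)
  total n>0 excess = let w , lt = ∑-<-witness {f = λ _ → 2 * weight fam} {λ w → 256 * N * N * E w} big in w , (begin-strict
      weight (through w) + weight (good w)        ≤⟨ +-mono-≤ (⊑-weight (λ _ → ∧-trueˡ)) (⊑-weight (λ _ → ∧-trueˡ)) ⟩
      weight fam + weight fam                     ≡⟨ cong (weight fam +_) (+-identityʳ (weight fam)) ⟨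
      2 * weight fam                              <⟨ lt ⟩
      256 * N * N * E w                           ≡⟨ cong (256 * N * N *_) (mass-dual (through w) (good w) (λ _ → ∧-trueˡ) (λ _ → ∧-trueˡ)) ⟨
      256 * N * N * mass true (through w) (good w) ∎)
    where
    open ≤-Reasoning
    instance
      N≢0 : NonZero N
      N≢0 = >-nonZero N>0
    E : Fin n → ℕ
    E w = mass false (good w) (through w)
    ⊑-weight : ∀ {a} → a ⊑ fam → weight a ≤ weight fam
    ⊑-weight {a} a⊑ = ∑S-mono each
      where
      each : ∀ S → a S ▸ W S ≤ fam S ▸ W S
      each S with a S in aS
      ... | false = z≤n
      ... | true rewrite a⊑ S aS = ≤-refl
    weight>0 : 0 < weight fam
    weight>0 = ≤-trans (1≤n! n) (*-cancelˡ-≤ N (≤-trans (m≤m+n (N * n !) _) excess))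
    pairs-dual : ∑S (λ A → fam A ▸ rem false A ! * H true one A) ≡ pairs
    pairs-dual = trans (∑S-cong λ S → cong (λ v → fam S ▸ v * H true one S) (sym (*-identityˡ (rem false S !))))
      (trans (H-duality one one) (∑S-cong λ S → cong (λ v → fam S ▸ v * H false one S) (*-identityˡ (rem true S !))))
    weight≤pairs : weight fam ≤ N * pairs
    weight≤pairs = +-cancelˡ-≤ (N * n !) _ _ (begin
      N * n ! + weight fam   ≤⟨ excess ⟩
      N * weight fam         ≤⟨ *-monoʳ-≤ N (≤-trans lubell (≤-reflexive (cong (_+ n !) pairs-dual))) ⟩
      N * (pairs + n !)      ≡⟨ *-distribˡ-+ N pairs (n !) ⟩
      N * pairs + N * n !    ≡⟨ +-comm (N * pairs) _ ⟩
      N * n ! + N * pairs    ∎)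
    summed : n * (2 * N) * pairs ≤ 64 * N * N * sum E + n * weight fam
    summed = begin
      n * (2 * N) * pairs
        ≡⟨ ∑S-* (n * (2 * N)) (λ B → fam B ▸ rem true B ! * H false one B) ⟨
      ∑S (λ B → n * (2 * N) * (fam B ▸ rem true B ! * H false one B))
        ≤⟨ ∑S-mono top-bound ⟩
      ∑S (λ B → 64 * N * N * e B + n * (fam B ▸ W B))
        ≡⟨ ∑S-+ (λ B → 64 * N * N * e B) (λ B → n * (fam B ▸ W B)) ⟩
      ∑S (λ B → 64 * N * N * e B) + ∑S (λ B → n * (fam B ▸ W B))
        ≡⟨ cong₂ _+_ (∑S-* (64 * N * N) e) (∑S-* n (λ B → fam B ▸ W B)) ⟩
      64 * N * N * ∑S e + n * weight fam
        ≡⟨ cong (λ v → 64 * N * N * v + n * weight fam) (∑S-∑ (λ w B → good w B ▸ rem true B ! * H false (ind (through w)) B)) ⟩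
      64 * N * N * sum E + n * weight fam ∎
      where
      e : Subset n → ℕ
      e B = ∑[ w < n ] (good w B ▸ rem true B ! * H false (ind (through w)) B)
    regroup : ∀ a b c → a * (2 * b) * c ≡ 2 * (a * (b * c))
    regroup = solve-∀
    quadruple : ∀ a b → 64 * a * a * b * 4 ≡ 256 * a * a * b
    quadruple = solve-∀
    one-share : n * weight fam ≤ 64 * N * N * sum E
    one-share = +-cancelʳ-≤ (n * weight fam) _ _ (begin
      n * weight fam + n * weight fam ≡⟨ cong (n * weight fam +_) (+-identityʳ (n * weight fam)) ⟨
      2 * (n * weight fam)            ≤⟨ *-monoʳ-≤ 2 (*-monoʳ-≤ n weight≤pairs) ⟩
      2 * (n * (N * pairs))           ≡⟨ regroup n N pairs ⟨
      n * (2 * N) * pairs             ≤⟨ summed ⟩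
      64 * N * N * sum E + n * weight fam ∎)
    big : ∑[ w < n ] (2 * weight fam) < ∑[ w < n ] (256 * N * N * E w)
    big = begin-strict
      ∑[ w < n ] (2 * weight fam)     ≡⟨ ∑-const n (2 * weight fam) ⟩
      -- The slack between 2 and 4 buys the strict inequality that `clean` starts from.
      n * (2 * weight fam)            <⟨ *-monoʳ-< n {{>-nonZero n>0}} (*-monoˡ-< (weight fam) {{>-nonZero weight>0}} {2} {4} (s≤s (s≤s (s≤s z≤n)))) ⟩
      n * (4 * weight fam)            ≡⟨ trans (cong (n *_) (*-comm 4 (weight fam))) (sym (*-assoc n (weight fam) 4)) ⟩
      n * weight fam * 4              ≤⟨ *-monoˡ-≤ 4 one-share ⟩
      64 * N * N * sum E * 4          ≡⟨ quadruple N (sum E) ⟩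
      256 * N * N * sum E             ≡⟨ *-distribˡ-sum (256 * N * N) E ⟩
      ∑[ w < n ] (256 * N * N * E w)  ∎

-- Growing the fence

dir : Bool → ℕ → Bool
dir b zero    = b
dir b (suc j) = dir (not b) j

-- Members of even index are the aᵢ, those of odd index the bᵢ; only a₁ and a_k omit w.
record Fence {n} (fam : Subset n → Bool) (j : ℕ) : Set where
  field
    w      : Fin n
    v      : ℕ → Subset n
    member : ∀ i → i ≤ 2 + j → fam (v i) ≡ true
    step   : ∀ i → i ≤ suc j → v i ⊑[ dir true i ] v (suc i)
    inside : ∀ i → i ≤ j → lookup (v (suc i)) w ≡ true
    first  : lookup (v 0) w ≡ false
    last   : lookup (v (2 + j)) w ≡ false
    -- One-sided: for even i an element of `v i` missing from `v l`, for odd i the reverse.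
    -- Neighbours are comparable, hence the gap 2.
    apart  : ∀ i l → 2 + i ≤ l → l ≤ 2 + j → ∃[ z ] lookup (v i) z ≡ dir true i × lookup (v l) z ≡ not (dir true i)

does-true : ∀ {P : Set} (d : Dec P) → does d ≡ true → P
does-true (yes p) _ = p

▸-positive : ∀ c {v} → 0 < c ▸ v → c ≡ true
▸-positive true _ = refl

-- K bounds the number of frozen coordinates. In `small`, 2 + K counts the bad events of a growth
-- step: staying below the earlier member, switching w, switching a frozen coordinate. In `small₀`
-- only the last kind occurs.
module FenceConstruction {n} (fam : Subset n → Bool) (lo s N K : ℕ)
  (lower : ∀ b T → fam T ≡ true → lo ≤ rem b T)
  (upper : ∀ b T → fam T ≡ true → rem b T ≤ lo + s)
  (lo>0 : 0 < lo) (N>0 : 0 < N) (n≤4lo : n ≤ 4 * lo) (narrow : 4 * N * s ≤ lo)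
  (small : 256 * N * N * (2 + K) * s < lo) (small₀ : 4 * N * K * s < lo) where

  open FirstHit fam
  open Spread fam lo s lower upper
  open Cleaning fam
  open Average fam lo s N lower upper lo>0 N>0 n≤4lo narrow

  module _ (w : Fin n) (a c : Subset n → Bool) (a⊑ : a ⊑ through w) (c⊑ : c ⊑ good w)
           (rich-a : Rich (256 * N * N) true a c) (rich-c : Rich (256 * N * N) false c a) where

    side : Bool → Subset n → Bool
    side true  = a
    side false = c

    side-rich : ∀ b → Rich (256 * N * N) b (side b) (side (not b))
    side-rich true  = rich-a
    side-rich false = rich-c

    side-fam : ∀ b → side b ⊑ fam
    side-fam true  S p = ∧-trueˡ (a⊑ S p)
    side-fam false S p = ∧-trueˡ (c⊑ S p)

    side-w : ∀ b S → side b S ≡ true → lookup S w ≡ true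
    side-w true  S p = ∧-trueʳ {fam S} (a⊑ S p)
    side-w false S p = ∧-trueˡ (∧-trueʳ {fam S} (c⊑ S p))

    -- D is the member before u, and X holds the coordinates frozen from now on: each coordinate z
    -- found by move-on separates the member two steps back from all later ones.
    record Walk (b : Bool) (D u : Subset n) (X : List (Fin n)) (j : ℕ) : Set where
      field
        v      : ℕ → Subset n
        start  : v 0 ≡ u
        member : ∀ i → i ≤ suc j → fam (v i) ≡ true
        step   : ∀ i → i ≤ j → v i ⊑[ dir b i ] v (suc i)
        inside : ∀ i → i ≤ j → lookup (v i) w ≡ true
        last   : lookup (v (suc j)) w ≡ false
        keep   : All (λ x → ∀ i → i ≤ suc j → lookup (v i) x ≡ lookup u x) X
        away   : ∀ i → i ≤ j → ∃[ z ] lookup D z ≡ not b × lookup (v (suc i)) z ≡ b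
        apart  : ∀ i l → 2 + i ≤ l → l ≤ suc j → ∃[ z ] lookup (v i) z ≡ dir b i × lookup (v l) z ≡ not (dir b i)

    -- Goodness is the hypothesis of `end-at` for B without w, a set that need not be a member. The
    -- chain goes down from there, so w cannot return.
    drop-w : ∀ B X → c B ≡ true → All (_≢ w) X → length X ≤ K →
             ∃[ T ] B ⊑[ false ] T × fam T ≡ true × lookup T w ≡ false × All (λ x → lookup T x ≡ lookup B x) X
    drop-w B X cB X≢w len =
      let S = B [ w ]≔ false
          T , le , T∈ , same = end-at false S X (4 * N)
            (≤-trans (<⇒≤ (≤-reflexive (rem-step false B w Bw))) (upper false B (side-fam false B cB)))
            (does-true (rem false S ! ≤? 4 * N * val false one S) (∧-trueʳ {lookup B w} (∧-trueʳ {fam B} (c⊑ B cB))))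
            (≤-<-trans (*-monoˡ-≤ s (*-monoʳ-≤ (4 * N) len)) small₀)
      in T , ⊑-trans B S T (flip-⊑ false B w) le , T∈ , le w (lookup∘update w B false) ,
         All.zipWith (λ {x} (e , x≢w) → trans e (lookup∘update′ x≢w B false)) (same , X≢w)
      where
      Bw : lookup B w ≡ true
      Bw = side-w false B cB

    -- The member D before u contains w unless D is a₁. In that case b = false and 0 < j, so the
    -- base case always has w in D.
    walk : ∀ j b D u X → fam D ≡ true → side b u ≡ true → u ⊑[ b ] D →
           lookup D w ≡ true ⊎ (b ≡ false × 0 < j) → dir b j ≡ false →
           All (_≢ w) X → length X + j ≤ K → Walk b D u X j
    walk zero .false D u X D∈ u∈ u⊑D (inj₁ Dw) refl X≢w len =
      let T , u⊑T , T∈ , Tw , same = drop-w u X u∈ X≢w (≤-trans (m≤m+n _ _) len) in record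
      { v      = λ { zero → u ; (suc _) → T }
      ; start  = refl
      ; member = λ { zero _ → side-fam false u u∈ ; (suc _) _ → T∈ }
      ; step   = λ { zero _ → u⊑T }
      ; inside = λ { zero _ → side-w false u u∈ }
      ; last   = Tw
      ; keep   = All.map (λ e → λ { zero _ → refl ; (suc _) _ → e }) same
      -- D contains w and T does not, so w itself separates them.
      ; away   = λ _ _ → w , Dw , Tw
      ; apart  = λ { i (suc zero) (s≤s ()) _ ; i (suc (suc _)) _ (s≤s ()) }
      }
    walk (suc j) b D u X D∈ u∈ u⊑D Dw end X≢w len =
      let T , u⊑T , T∈ , T>0 , same , z , Dz , Tz =
            move-on b D u (w ∷ X) (ind (side (not b))) (256 * N * N) (ind-≤1 (side (not b))) (side-fam b u u∈) D∈ u⊑D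
              (side-rich b u u∈) (≤-<-trans (*-monoˡ-≤ s (*-monoʳ-≤ (256 * N * N) (s≤s (s≤s (≤-trans (m≤m+n _ _) len))))) small)
          T-side = ▸-positive (side (not b) T) T>0
          -- From T on z is frozen, so it separates D from every later member. It must differ from
          -- w, because the final step switches w.
          W = walk j (not b) u T (z ∷ X) (side-fam b u u∈) T-side (⊑-reverse u T u⊑T) (inj₁ (side-w b u u∈)) end
                ((λ z≡w → z≢w T (side-w (not b) T T-side) (subst (λ y → lookup D y ≡ not b) z≡w Dz) (subst (λ y → lookup T y ≡ b) z≡w Tz) Dw) ∷ X≢w)
                (subst (_≤ K) (+-suc (length X) j) len)
          module W = Walk W
      in record
      { v      = λ { zero → u ; (suc i) → W.v i }
      ; start  = refl
      ; member = λ { zero _ → side-fam b u u∈ ; (suc i) (s≤s le) → W.member i le }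
      ; step   = λ { zero _ → subst (u ⊑[ b ]_) (sym W.start) u⊑T ; (suc i) (s≤s le) → W.step i le }
      ; inside = λ { zero _ → side-w b u u∈ ; (suc i) (s≤s le) → W.inside i le }
      ; last   = W.last
      ; keep   = All.zipWith (λ { (k , e) zero _ → refl ; (k , e) (suc i) (s≤s le) → trans (k i le) e }) (All.tail W.keep , All.tail same)
      ; away   = λ i le → z , Dz , trans (All.head W.keep i le) Tz
      ; apart  = λ { zero (suc zero) (s≤s ()) _
                   ; zero (suc (suc l)) _ (s≤s (s≤s le)) → let y , uy , vy = W.away l le in y , trans uy (not-involutive b) , vy
                   ; (suc i) (suc l) (s≤s gap) (s≤s le) → W.apart i l gap le }
      }
      where
      z≢w : ∀ T → lookup T w ≡ true → lookup D w ≡ not b → lookup T w ≡ b → ¬ (lookup D w ≡ true ⊎ (b ≡ false × 0 < suc j))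
      z≢w T Tw Dw′ Tb (inj₁ Dw) = contradiction (trans (sym Dw) (trans Dw′ (cong not (trans (sym Tb) Tw)))) λ ()
      z≢w T Tw Dw′ Tb (inj₂ (refl , _)) = contradiction (trans (sym Tw) Tb) λ ()

    -- Growth starts at b₁ and not at a₁: only members of `c` are good, so a₁ is obtained from b₁ by
    -- `drop-w`, with nothing frozen yet. Evenness of j makes the walk end with a step down, the
    -- other use of `drop-w`.
    fence : ∀ j → dir false j ≡ false → 0 < j → j ≤ K → 0 < mass true a c → Fence fam j
    fence j even j>0 j≤K m>0 =
      let S , S>0 = ∑S-positive {f = λ S → a S ▸ rem false S ! * H true (ind c) S} m>0
          B , _ , _ , B∈ , B>0 = H-witness {true} {ind c} {S} (factor-positive (rem false S !) (≤-trans S>0 (▸-≤ (a S) _)))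
          cB = ▸-positive (c B) B>0
          A , B⊑A , A∈ , Aw , _ = drop-w B [] cB [] z≤n
          module W = Walk (walk j false A B [] A∈ cB B⊑A (inj₂ (refl , j>0)) even [] j≤K)
      in record
      { w      = w
      ; v      = λ { zero → A ; (suc i) → W.v i }
      ; member = λ { zero _ → A∈ ; (suc i) (s≤s le) → W.member i le }
      ; step   = λ { zero _ → subst (A ⊑[ true ]_) (sym W.start) (⊑-reverse B A B⊑A) ; (suc i) (s≤s le) → W.step i le }
      ; inside = W.inside
      ; first  = Aw
      ; last   = W.last
      ; apart  = λ { zero (suc zero) (s≤s ()) _
                   ; zero (suc (suc l)) _ (s≤s (s≤s le)) → W.away l le
                   ; (suc i) (suc l) (s≤s gap) (s≤s le) → W.apart i l gap le }
      }

  build : ∀ j → dir false j ≡ false → 0 < j → j ≤ K → 0 < n → N * n ! + weight fam ≤ N * weight fam → Fence fam j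
  build j even j>0 j≤K n>0 excess =
    let w , big = total n>0 excess
        a , c , a⊑ , c⊑ , rich-a , rich-c , m>0 =
          clean (256 * N * N) (through w) (good w) (λ _ → ∧-trueˡ) (λ _ → ∧-trueˡ) big
    in fence w a c a⊑ c⊑ rich-a rich-c j even j>0 j≤K m>0

-- From the fence to the poset

double : ℕ → ℕ
double zero    = zero
double (suc m) = suc (suc (double m))

double-mono : ∀ {i l} → i ≤ l → double i ≤ double l
double-mono z≤n     = z≤n
double-mono (s≤s p) = s≤s (s≤s (double-mono p))

dir-double : ∀ b i → dir b (double i) ≡ b
dir-double b zero    = refl
dir-double b (suc i) = trans (cong (λ c → dir c (double i)) (not-involutive b)) (dir-double b i)

≼-antisym : ∀ {k} (p q : PElt k) → p ≼ q → q ≼ p → p ≡ q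
≼-antisym (inj₁ _) (inj₁ _) eq _ = cong inj₁ eq
≼-antisym (inj₂ _) (inj₂ _) eq _ = cong inj₂ eq

⊆⇒⊑ : ∀ {n} {S T : Subset n} → S ⊆ T → S ⊑[ true ] T
⊆⇒⊑ {S = S} sub x eq = []=⇒lookup (sub (lookup⇒[]= x S eq))

⊑⇒⊆ : ∀ {n} {S T : Subset n} → S ⊑[ true ] T → S ⊆ T
⊑⇒⊆ {T = T} le {x} x∈ = lookup⇒[]= x T (le x ([]=⇒lookup x∈))

module Embedding {n} (fam : Subset n → Bool) (k : ℕ) (F : Fence fam (double (suc k))) where
  open Fence F

  private
    -- v runs through a₁, b₁, a₂, …, a_k; the indices below are those of Defs, from 0.
    a b : ℕ → Subset n
    a i = v (double i)
    b l = v (suc (double l))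

  a⊑b : ∀ i → i ≤ suc k → a i ⊑[ true ] b i
  a⊑b i le = subst (λ c → a i ⊑[ c ] b i) (dir-double true i) (step (double i) (≤-trans (double-mono le) (n≤1+n _)))

  a⁺⊑b : ∀ l → l ≤ suc k → a (suc l) ⊑[ true ] b l
  a⁺⊑b l le = ⊑-reverse (b l) (a (suc l)) (subst (λ c → b l ⊑[ c ] a (suc l)) (dir-double false l) (step (suc (double l)) (s≤s (double-mono le))))

  clash : ∀ (S T : Subset n) {z} → S ⊑[ true ] T → lookup S z ≡ true → ¬ (lookup T z ≡ false)
  clash S T le Sz Tz = contradiction (trans (sym (le _ Sz)) Tz) λ ()

  a⊑b⇒adjacent : ∀ i l → i ≤ 2 + k → l ≤ suc k → a i ⊑[ true ] b l → i ≡ l ⊎ i ≡ suc l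
  a⊑b⇒adjacent i l i≤ l≤ le with <-cmp i l
  ... | tri≈ _ eq _ = inj₁ eq
  ... | tri< i<l _ _ =
    let z , az , bz = apart (double i) (suc (double l)) (≤-trans (double-mono i<l) (n≤1+n _)) (s≤s (≤-trans (double-mono l≤) (n≤1+n _)))
    in contradiction (trans bz (cong not (dir-double true i))) (clash (a i) (b l) le (trans az (dir-double true i)))
  ... | tri> _ _ l<i with m≤n⇒m<n∨m≡n l<i
  ...   | inj₂ eq = inj₂ (sym eq)
  ...   | inj₁ 2+l≤i =
    let z , bz , az = apart (suc (double l)) (double i) (≤-trans (n≤1+n _) (double-mono 2+l≤i)) (double-mono i≤)
    in contradiction (trans bz (dir-double false l)) (clash (a i) (b l) le (trans az (cong not (dir-double false l))))

  -- For i < i′ `apart` applies directly. For i′ < i it separates the wrong way, so `a i′` is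
  -- enlarged to the b just before it, which `a⊑b⇒adjacent` forbids.
  a⊑a⇒≡ : ∀ i i′ → i ≤ 2 + k → i′ ≤ 2 + k → a i ⊑[ true ] a i′ → i ≡ i′
  a⊑a⇒≡ i i′ i≤ i′≤ le with <-cmp i i′
  ... | tri≈ _ eq _ = eq
  ... | tri< i<i′ _ _ =
    let z , az , a′z = apart (double i) (double i′) (double-mono i<i′) (double-mono i′≤)
    in contradiction (trans a′z (cong not (dir-double true i))) (clash (a i) (a i′) le (trans az (dir-double true i)))
  ... | tri> _ _ i′<i = ⊥-elim (higher i′ i′≤ le i′<i)
    where
    higher : ∀ i′ → i′ ≤ 2 + k → a i ⊑[ true ] a i′ → ¬ (i′ < i)
    higher (suc i″) (s≤s i″≤) le i″<i with a⊑b⇒adjacent i i″ i≤ i″≤ (⊑-trans (a i) (a (suc i″)) (b i″) le (a⁺⊑b i″ i″≤))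
    ... | inj₁ refl = <-irrefl refl (<-trans (n<1+n _) i″<i)
    ... | inj₂ refl = <-irrefl refl i″<i
    higher zero _ le 0<i with a⊑b⇒adjacent i 0 i≤ z≤n (⊑-trans (a i) (a 0) (b 0) le (a⊑b 0 z≤n))
    ... | inj₁ refl = <-irrefl refl 0<i
    -- Only a₁ has no b before it. The b after it leaves i = 1 open, and w decides: a₂ contains w,
    -- a₁ does not.
    ... | inj₂ refl = clash (a 1) (a 0) le (inside 1 (s≤s z≤n)) first

  G : PElt (3 + k) → Subset n
  G (inj₁ i) = a (toℕ i)
  G (inj₂ l) = b (toℕ l)

  G-member : ∀ p → fam (G p) ≡ true
  G-member (inj₁ i) = member (double (toℕ i)) (double-mono (toℕ≤pred[n] i))
  G-member (inj₂ l) = member (suc (double (toℕ l))) (s≤s (≤-trans (double-mono (toℕ≤pred[n] l)) (n≤1+n _)))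

  ≼⇒⊑ : ∀ p q → p ≼ q → G p ⊑[ true ] G q
  ≼⇒⊑ (inj₁ i) (inj₁ .i) refl = ⊑-refl (a (toℕ i))
  ≼⇒⊑ (inj₂ l) (inj₂ .l) refl = ⊑-refl (b (toℕ l))
  ≼⇒⊑ (inj₁ i) (inj₂ l) (inj₁ eq) rewrite eq = a⊑b (toℕ l) (toℕ≤pred[n] l)
  ≼⇒⊑ (inj₁ i) (inj₂ l) (inj₂ eq) rewrite eq = a⁺⊑b (toℕ l) (toℕ≤pred[n] l)

  -- A b is compared through the two a's under it: inside an a, both would equal that a; inside
  -- another b, both would be adjacent to it, which holds only for its own pair.
  ⊑⇒≼ : ∀ p q → G p ⊑[ true ] G q → p ≼ q
  ⊑⇒≼ (inj₁ i) (inj₁ i′) le = toℕ-injective (a⊑a⇒≡ (toℕ i) (toℕ i′) (toℕ≤pred[n] i) (toℕ≤pred[n] i′) le)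
  ⊑⇒≼ (inj₁ i) (inj₂ l) le = a⊑b⇒adjacent (toℕ i) (toℕ l) (toℕ≤pred[n] i) (toℕ≤pred[n] l) le
  ⊑⇒≼ (inj₂ l) (inj₁ i) le =
    let l≤ = toℕ≤pred[n] l
        i≤ = toℕ≤pred[n] i
        eq₁ = a⊑a⇒≡ (toℕ l) (toℕ i) (m≤n⇒m≤1+n l≤) i≤ (⊑-trans (a (toℕ l)) (b (toℕ l)) (a (toℕ i)) (a⊑b (toℕ l) l≤) le)
        eq₂ = a⊑a⇒≡ (suc (toℕ l)) (toℕ i) (s≤s l≤) i≤ (⊑-trans (a (suc (toℕ l))) (b (toℕ l)) (a (toℕ i)) (a⁺⊑b (toℕ l) l≤) le)
    in 1+n≢n (trans eq₂ (sym eq₁))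
  ⊑⇒≼ (inj₂ l) (inj₂ l′) le =
    let l≤ = toℕ≤pred[n] l
        l′≤ = toℕ≤pred[n] l′
        near₁ = a⊑b⇒adjacent (toℕ l) (toℕ l′) (m≤n⇒m≤1+n l≤) l′≤ (⊑-trans (a (toℕ l)) (b (toℕ l)) (b (toℕ l′)) (a⊑b (toℕ l) l≤) le)
        near₂ = a⊑b⇒adjacent (suc (toℕ l)) (toℕ l′) (s≤s l≤) l′≤ (⊑-trans (a (suc (toℕ l))) (b (toℕ l)) (b (toℕ l′)) (a⁺⊑b (toℕ l) l≤) le)
    in toℕ-injective (both near₁ near₂)
    where
    both : ∀ {x y} → x ≡ y ⊎ x ≡ suc y → suc x ≡ y ⊎ suc x ≡ suc y → x ≡ y
    both (inj₁ eq)   _           = eq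
    both (inj₂ _)    (inj₂ eq)   = suc-injective eq
    both (inj₂ refl) (inj₁ eq)   = contradiction eq (m+1+n≢m _ ∘ trans (+-comm _ 2))

  G-⇔ : ∀ p q → (p ≼ q) ⇔ (G p ⊆ G q)
  G-⇔ p q = mk⇔ to from
    where
    to : p ≼ q → G p ⊆ G q
    to le = ⊑⇒⊆ {S = G p} {G q} (≼⇒⊑ p q le)
    from : G p ⊆ G q → p ≼ q
    from sub = ⊑⇒≼ p q (⊆⇒⊑ {S = G p} {G q} sub)

  G-injective : Injective _≡_ _≡_ G
  G-injective {p} {q} eq = ≼-antisym p q
    (⊑⇒≼ p q (subst (G p ⊑[ true ]_) eq (⊑-refl (G p))))
    (⊑⇒≼ q p (subst (_⊑[ true ] G p) eq (⊑-refl (G p))))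

  G-private : ∀ (i j l : Fin (3 + k)) → toℕ j ≡ 0 → toℕ l ≡ 2 + k → 1 ≤ toℕ i → toℕ i < 2 + k →
              ¬ (G (inj₁ i) ⊆ (G (inj₁ j) ∪ G (inj₁ l)))
  G-private i j l j≡ l≡ 1≤i i< sub with x∈p∪q⁻ (G (inj₁ j)) (G (inj₁ l)) (sub (lookup⇒[]= w (a (toℕ i)) (w∈ (toℕ i) 1≤i i<)))
    where
    w∈ : ∀ i → 1 ≤ i → i < 2 + k → lookup (a i) w ≡ true
    w∈ (suc i) _ (s≤s (s≤s le)) = inside (suc (double i)) (≤-trans (s≤s (double-mono le)) (n≤1+n _))
  ... | inj₁ w∈ = contradiction (trans (sym ([]=⇒lookup w∈)) (trans (cong (λ t → lookup (a t) w) j≡) first)) λ ()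
  ... | inj₂ w∈ = contradiction (trans (sym ([]=⇒lookup w∈)) (trans (cong (λ t → lookup (a t) w) l≡) last)) λ ()

-- Numerical estimates

-- The first two terms of the binomial expansion of the right side.
pow-step : ∀ m K → m ^ suc K + suc K * m ^ K ≤ suc m ^ suc K
pow-step m zero    = ≤-reflexive (base m)
  where
  base : ∀ m → m * 1 + 1 * 1 ≡ suc m * 1
  base = solve-∀
pow-step m (suc K) = begin
  m ^ suc (suc K) + suc (suc K) * m ^ suc K            ≤⟨ m≤m+n _ (suc K * m ^ K) ⟩
  m ^ suc (suc K) + suc (suc K) * m ^ suc K + suc K * m ^ K ≡⟨ expand m K (m ^ K) ⟨
  suc m * (m ^ suc K + suc K * m ^ K)                  ≤⟨ *-monoʳ-≤ (suc m) (pow-step m K) ⟩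
  suc m ^ suc (suc K)                                  ∎
  where
  open ≤-Reasoning
  expand : ∀ m K p → suc m * (m * p + suc K * p) ≡ m * (m * p) + suc (suc K) * (m * p) + suc K * p
  expand = solve-∀

-- Truncated form of 2 e^m ≤ e^(m+1), scaled by (K+1)!: the left side adds the partial sums up to K
-- + 1 and up to K.
expPartialScaled-step : ∀ m K → expPartialScaled m (suc K) + suc K * expPartialScaled m K ≤ expPartialScaled (suc m) (suc K)
expPartialScaled-step m zero    = ≤-reflexive (base m)
  where
  base : ∀ m → 1 * 1 + m * 1 + 1 * 1 ≡ 1 * 1 + suc m * 1
  base = solve-∀
expPartialScaled-step m (suc K) = begin
  suc (suc K) * (suc K * e + p) + m * p + suc (suc K) * (suc K * e + p)
    ≡⟨ regroup (suc K) e p (m * p) ⟩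
  suc (suc K) * ((suc K * e + p) + suc K * e) + (m * p + suc (suc K) * p)
    ≤⟨ +-mono-≤ (*-monoʳ-≤ (suc (suc K)) (expPartialScaled-step m K)) (pow-step m (suc K)) ⟩
  expPartialScaled (suc m) (suc (suc K)) ∎
  where
  open ≤-Reasoning
  e p : ℕ
  e = expPartialScaled m K
  p = m ^ suc K
  regroup : ∀ k e p q → suc k * (k * e + p) + q + suc k * (k * e + p) ≡ suc k * ((k * e + p) + k * e) + (q + suc k * p)
  regroup = solve-∀

2^m≤exp : ∀ m K → m ≤ K → 2 ^ m * K ! ≤ expPartialScaled m K
2^m≤exp zero    zero    _ = ≤-refl
2^m≤exp zero    (suc K) _ = begin
  1 * (suc K * K !)               ≡⟨ *-identityˡ _ ⟩
  suc K * K !                     ≤⟨ *-monoʳ-≤ (suc K) (≤-trans (≤-reflexive (sym (*-identityˡ (K !)))) (2^m≤exp zero K z≤n)) ⟩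
  suc K * expPartialScaled 0 K    ≤⟨ m≤m+n _ _ ⟩
  expPartialScaled 0 (suc K)      ∎
  where open ≤-Reasoning
2^m≤exp (suc m) (suc K) (s≤s m≤K) = begin
  2 * 2 ^ m * suc K !                                             ≡⟨ regroup (2 ^ m) (suc K) (K !) ⟩
  2 ^ m * suc K ! + suc K * (2 ^ m * K !)                         ≤⟨ +-mono-≤ (2^m≤exp m (suc K) (m≤n⇒m≤1+n m≤K)) (*-monoʳ-≤ (suc K) (2^m≤exp m K m≤K)) ⟩
  expPartialScaled m (suc K) + suc K * expPartialScaled m K       ≤⟨ expPartialScaled-step m K ⟩
  expPartialScaled (suc m) (suc K)                                ∎
  where
  open ≤-Reasoning
  regroup : ∀ a k f → 2 * a * (k * f) ≡ a * (k * f) + k * (a * f)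
  regroup = solve-∀

ExpLe⇒2^ : ∀ m N → ExpLe m N → 2 ^ m ≤ N
ExpLe⇒2^ m N h = *-cancelʳ-≤ _ _ (m !) {{m !≢0}} (≤-trans (2^m≤exp m m ≤-refl) (h m))

m<2^m : ∀ m → m < 2 ^ m
m<2^m zero    = s≤s z≤n
m<2^m (suc m) = ≤-trans (s≤s (m<2^m m)) (≤-trans (+-monoˡ-≤ (2 ^ m) (m^n>0 2 m)) (≤-reflexive (cong (2 ^ m +_) (sym (+-identityʳ _)))))

-- At l = 3c the power splits as 2^c * 4^c, with c ≤ 2^c and 3c + 1 ≤ 4^c; beyond that, doubling
-- outruns adding c.
linear≤2^ : ∀ c l → 3 * c ≤ l → c * suc l ≤ 2 ^ l
linear≤2^ c l h = subst (λ l → c * suc l ≤ 2 ^ l) (m+[n∸m]≡n h) (go (l ∸ 3 * c))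
  where
  open ≤-Reasoning
  4^ : ∀ c → suc (3 * c) ≤ 2 ^ (2 * c)
  4^ zero    = s≤s z≤n
  4^ (suc c) = begin
    suc (3 * suc c)         ≡⟨ expand c ⟩
    suc (3 * c) + 3         ≤⟨ +-monoʳ-≤ (suc (3 * c)) (*-monoʳ-≤ 3 (s≤s z≤n)) ⟩
    suc (3 * c) + 3 * suc (3 * c) ≡⟨ fourfold (suc (3 * c)) ⟩
    2 * (2 * suc (3 * c))   ≤⟨ *-monoʳ-≤ 2 (*-monoʳ-≤ 2 (4^ c)) ⟩
    2 ^ (2 + 2 * c)         ≡⟨ cong (2 ^_) (sym (*-suc 2 c)) ⟩
    2 ^ (2 * suc c)         ∎
    where
    expand : ∀ c → suc (3 * suc c) ≡ suc (3 * c) + 3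
    expand = solve-∀
    fourfold : ∀ a → a + 3 * a ≡ 2 * (2 * a)
    fourfold = solve-∀
  go : ∀ j → c * suc (3 * c + j) ≤ 2 ^ (3 * c + j)
  go zero    = begin
    c * suc (3 * c + 0)     ≡⟨ cong (λ t → c * suc t) (+-identityʳ (3 * c)) ⟩
    c * suc (3 * c)         ≤⟨ *-mono-≤ (<⇒≤ (m<2^m c)) (4^ c) ⟩
    2 ^ c * 2 ^ (2 * c)     ≡⟨ ^-distribˡ-+-* 2 c (2 * c) ⟨
    2 ^ (3 * c)             ≡⟨ cong (2 ^_) (+-identityʳ (3 * c)) ⟨
    2 ^ (3 * c + 0)         ∎
  go (suc j) = begin
    c * suc (3 * c + suc j)   ≡⟨ cong (λ t → c * suc t) (+-suc (3 * c) j) ⟩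
    c * suc (suc (3 * c + j)) ≡⟨ *-suc c _ ⟩
    c + c * suc (3 * c + j)   ≤⟨ +-monoˡ-≤ _ (m≤m*n c (suc (3 * c + j))) ⟩
    c * suc (3 * c + j) + c * suc (3 * c + j) ≡⟨ cong (c * suc (3 * c + j) +_) (+-identityʳ _) ⟨
    2 * (c * suc (3 * c + j)) ≤⟨ *-monoʳ-≤ 2 (go j) ⟩
    2 ^ suc (3 * c + j)       ≡⟨ cong (2 ^_) (+-suc (3 * c) j) ⟨
    2 ^ (3 * c + suc j)       ∎

binary-scale : ∀ m → ∃[ l ] 2 ^ l ≤ suc m × suc m < 2 ^ suc l
binary-scale zero    = 0 , ≤-refl , ≤-refl
binary-scale (suc m) with binary-scale m
... | l , lo , hi with suc (suc m) <? 2 ^ suc l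
...   | yes lt = l , m≤n⇒m≤1+n lo , lt
...   | no ≮   = suc l , ≮⇒≥ ≮ , ≤-<-trans hi (^-monoʳ-< 2 (s≤s (s≤s z≤n)) (n<1+n (suc l)))

-- If 2^l ≤ n < 2^(l+1), then n^c ≤ 2^(c(l+1)), and c(l+1) ≤ 2^l ≤ n because l ≥ 3c.
n^c≤2^n : ∀ c n → 2 ^ (3 * c) ≤ n → n ^ c ≤ 2 ^ n
n^c≤2^n c zero    h = contradiction (≤-trans (m^n>0 2 (3 * c)) h) λ ()
n^c≤2^n c (suc m) h with binary-scale m
... | l , lo , hi = begin
  suc m ^ c            ≤⟨ ^-monoˡ-≤ c (<⇒≤ hi) ⟩
  (2 ^ suc l) ^ c      ≡⟨ ^-*-assoc 2 (suc l) c ⟩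
  2 ^ (suc l * c)      ≤⟨ ^-monoʳ-≤ 2 (≤-trans (≤-reflexive (*-comm (suc l) c)) (≤-trans (linear≤2^ c l (≮⇒≥ l≮)) lo)) ⟩
  2 ^ suc m            ∎
  where
  open ≤-Reasoning
  l≮ : ¬ (l < 3 * c)
  l≮ lt = <-irrefl refl (<-≤-trans hi (≤-trans (^-monoʳ-≤ 2 lt) h))

-- Otherwise 2^(n²) < 2^(d²R²) ≤ n^(16nR²) ≤ 2^(n²). Weakening e to 2 costs nothing that matters, as
-- d only has to be a small fraction of n.
deviation : ∀ R n d → 2 ^ (3 * (16 * (R * R))) ≤ n → ExpLe (d * d) (n ^ (16 * n)) → d * R ≤ n
deviation R n d large h = ≮⇒≥ λ n<dR → <-irrefl refl (begin-strict
  2 ^ (n * n)                   <⟨ ^-monoʳ-< 2 (s≤s (s≤s z≤n)) (*-mono-< n<dR n<dR) ⟩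
  2 ^ (d * R * (d * R))         ≡⟨ cong (2 ^_) (square d R) ⟩
  2 ^ (d * d * (R * R))         ≡⟨ ^-*-assoc 2 (d * d) (R * R) ⟨
  (2 ^ (d * d)) ^ (R * R)       ≤⟨ ^-monoˡ-≤ (R * R) (ExpLe⇒2^ (d * d) (n ^ (16 * n)) h) ⟩
  (n ^ (16 * n)) ^ (R * R)      ≡⟨ ^-*-assoc n (16 * n) (R * R) ⟩
  n ^ (16 * n * (R * R))        ≡⟨ cong (n ^_) (regroup n (R * R)) ⟩
  n ^ (16 * (R * R) * n)        ≡⟨ ^-*-assoc n (16 * (R * R)) n ⟨
  (n ^ (16 * (R * R))) ^ n      ≤⟨ ^-monoˡ-≤ n (n^c≤2^n (16 * (R * R)) n large) ⟩
  (2 ^ n) ^ n                   ≡⟨ ^-*-assoc 2 n n ⟩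
  2 ^ (n * n)                   ∎)
  where
  open ≤-Reasoning
  square : ∀ d r → d * r * (d * r) ≡ d * d * (r * r)
  square = solve-∀
  regroup : ∀ n r → 16 * n * r ≡ 16 * r * n
  regroup = solve-∀

-- Factorials and the central binomial coefficient

!-shift : ∀ t {a d} → a ≤ d → (a + t) ! * d ! ≤ a ! * (d + t) !
!-shift zero    {a} {d} _ = ≤-reflexive (cong₂ (λ x y → x ! * y !) (+-identityʳ a) (sym (+-identityʳ d)))
!-shift (suc t) {a} {d} h = begin
  (a + suc t) ! * d !                  ≡⟨ cong (λ x → x ! * d !) (+-suc a t) ⟩
  suc (a + t) * (a + t) ! * d !        ≡⟨ *-assoc (suc (a + t)) ((a + t) !) (d !) ⟩
  suc (a + t) * ((a + t) ! * d !)      ≤⟨ *-mono-≤ (s≤s (+-monoˡ-≤ t h)) (!-shift t h) ⟩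
  suc (d + t) * (a ! * (d + t) !)      ≡⟨ swap (suc (d + t)) (a !) ((d + t) !) ⟩
  a ! * (suc (d + t) * (d + t) !)      ≡⟨ cong (λ x → a ! * x !) (+-suc d t) ⟨
  a ! * (d + suc t) !                  ∎
  where
  open ≤-Reasoning
  swap : ∀ a b c → a * (b * c) ≡ b * (a * c)
  swap = solve-∀

-- By `!-shift`, moving t units from the larger argument to the smaller cannot raise a product of
-- factorials. For i > h the shift needs j ≤ h, which follows from g ≤ h + 1.
balanced-! : ∀ i j h g → i + j ≡ h + g → h ≤ g → g ≤ suc h → h ! * g ! ≤ i ! * j !
balanced-! i j h g eq h≤g g≤ with i ≤? h
... | yes i≤h = let t = h ∸ i in begin
    h ! * g !              ≡⟨ cong (λ x → x ! * g !) (m+[n∸m]≡n i≤h) ⟨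
    (i + t) ! * g !        ≤⟨ !-shift t (≤-trans i≤h h≤g) ⟩
    i ! * (g + t) !        ≡⟨ cong (λ x → i ! * x !) (+-cancelˡ-≡ i (g + t) j (trans (rotate i g t) (trans (cong (_+ g) (m+[n∸m]≡n i≤h)) (sym eq)))) ⟩
    i ! * j !              ∎
  where
  open ≤-Reasoning
  rotate : ∀ i g t → i + (g + t) ≡ i + t + g
  rotate = solve-∀
... | no i≰h = let t = i ∸ h ; j+t≡g = +-cancelˡ-≡ h (j + t) g (trans (rotate h j t) (trans (cong (_+ j) (m+[n∸m]≡n h≤i)) eq)) in begin
    h ! * g !              ≡⟨ cong (λ x → h ! * x !) j+t≡g ⟨
    h ! * (j + t) !        ≡⟨ *-comm (h !) _ ⟩
    (j + t) ! * h !        ≤⟨ !-shift t j≤h ⟩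
    j ! * (h + t) !        ≡⟨ cong (λ x → j ! * x !) (m+[n∸m]≡n h≤i) ⟩
    j ! * i !              ≡⟨ *-comm (j !) _ ⟩
    i ! * j !              ∎
  where
  open ≤-Reasoning
  h≤i : h ≤ i
  h≤i = <⇒≤ (≰⇒> i≰h)
  rotate : ∀ i g t → i + (g + t) ≡ i + t + g
  rotate = solve-∀
  j≤h : j ≤ h
  j≤h = +-cancelˡ-≤ i j h (≤-trans (≤-reflexive eq) (≤-trans (+-monoʳ-≤ h g≤)
    (≤-trans (≤-reflexive (+-suc h h)) (+-monoˡ-≤ h (≰⇒> i≰h)))))

halves : ∀ n → n / 2 ≤ n ∸ n / 2 × n ∸ n / 2 ≤ suc (n / 2) × n / 2 ≤ n
halves n = ≤-trans (m≤n+m h (n % 2)) (≤-reflexive (sym rest)) ,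
           ≤-trans (≤-reflexive rest) (+-monoˡ-≤ h (≤-pred (m%n<n n 2))) ,
           ≤-trans (m≤n+m h (n % 2 + h)) (≤-reflexive (sym whole))
  where
  h : ℕ
  h = n / 2
  whole : n ≡ n % 2 + h + h
  whole = trans (m≡m%n+[m/n]*n n 2) (trans (cong (n % 2 +_) (trans (*-comm h 2) (cong (h +_) (+-identityʳ h)))) (sym (+-assoc (n % 2) h h)))
  rest : n ∸ h ≡ n % 2 + h
  rest = trans (cong (_∸ h) whole) (m+n∸n≡m (n % 2 + h) h)

n!≤central : ∀ n i j → i + j ≡ n → n ! ≤ (n C (n / 2)) * (i ! * j !)
n!≤central n i j eq =
  let h≤ , ≤sh , h≤n = halves n in begin
  n !                                            ≡⟨ m/n*n≡m {{nz}} (k![n∸k]!∣n! h≤n) ⟨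
  (n ! / (h ! * (n ∸ h) !)) {{nz}} * (h ! * (n ∸ h) !) ≡⟨ cong (_* (h ! * (n ∸ h) !)) (nCk≡n!/k![n-k]! h≤n) ⟨
  (n C h) * (h ! * (n ∸ h) !)                    ≤⟨ *-monoʳ-≤ (n C h) (balanced-! i j h (n ∸ h) (trans eq (sym (m+[n∸m]≡n h≤n))) h≤ ≤sh) ⟩
  (n C h) * (i ! * j !)                          ∎
  where
  open ≤-Reasoning
  h : ℕ
  h = n / 2
  nz : NonZero (h ! * (n ∸ h) !)
  nz = h !* (n ∸ h) !≢0

-- From a list and a rational ε to indicators and natural numbers

member : ∀ {n} → List (Subset n) → Subset n → Bool
member 𝓕 S = does (DecMembership._∈?_ _≟S_ S 𝓕)

member-∈ : ∀ {n} (𝓕 : List (Subset n)) {S} → member 𝓕 S ≡ true → S ∈ 𝓕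
member-∈ 𝓕 {S} = does-true (DecMembership._∈?_ _≟S_ S 𝓕)

length≤∑S : ∀ {n} (φ : Subset n → ℕ) m (𝓕 : List (Subset n)) → Unique 𝓕 → (∀ S → m ≤ φ S) →
            length 𝓕 * m ≤ ∑S (λ S → member 𝓕 S ▸ φ S)
length≤∑S φ m []       []       h = z≤n
length≤∑S φ m (F ∷ 𝓕) (F∉ ∷ u) h = begin
  m + length 𝓕 * m                                              ≤⟨ +-mono-≤ (h F) (length≤∑S φ m 𝓕 u h) ⟩
  φ F + ∑S (λ S → member 𝓕 S ▸ φ S)                             ≡⟨ cong (_+ ∑S (λ S → member 𝓕 S ▸ φ S)) (∑S-indicator F φ) ⟨
  ∑S (λ S → does (S ≟S F) ▸ φ S) + ∑S (λ S → member 𝓕 S ▸ φ S)  ≡⟨ ∑S-+ (λ S → does (S ≟S F) ▸ φ S) (λ S → member 𝓕 S ▸ φ S) ⟨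
  ∑S (λ S → does (S ≟S F) ▸ φ S + member 𝓕 S ▸ φ S)             ≤⟨ ∑S-mono each ⟩
  ∑S (λ S → member (F ∷ 𝓕) S ▸ φ S)                             ∎
  where
  open ≤-Reasoning
  disjoint : ∀ {P Q R : Set} (p : Dec P) (q : Dec Q) (r : Dec R) v → (P → Q → R) → (P → ¬ Q) → (Q → R) → (P → R) →
             does p ▸ v + does q ▸ v ≤ does r ▸ v
  disjoint (yes p) (yes q) _ v _ pq _ _ = contradiction q (pq p)
  disjoint (yes p) (no _) (yes _) v _ _ _ _ = ≤-reflexive (+-identityʳ v)
  disjoint (yes p) (no _) (no ¬r) v _ _ _ pr = contradiction (pr p) ¬r
  disjoint (no _) (yes q) (yes _) v _ _ _ _ = ≤-refl
  disjoint (no _) (yes q) (no ¬r) v _ _ qr _ = contradiction (qr q) ¬r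
  disjoint (no _) (no _) _ v _ _ _ _ = z≤n
  each : ∀ S → does (S ≟S F) ▸ φ S + member 𝓕 S ▸ φ S ≤ member (F ∷ 𝓕) S ▸ φ S
  each S = disjoint (S ≟S F) (DecMembership._∈?_ _≟S_ S 𝓕) (DecMembership._∈?_ _≟S_ S (F ∷ 𝓕)) (φ S)
    (λ { refl _ → here refl }) (λ { refl S∈ → All.lookup F∉ S∈ refl }) there here

half : ∀ m → ∃[ h ] h + h ≤ m × m ≤ suc (h + h)
half zero    = 0 , z≤n , z≤n
half (suc m) with half m
... | h , lo , hi with h + h ≟ m
...   | yes refl = h , n≤1+n _ , ≤-refl
...   | no h≢    = suc h , subst (_≤ suc m) (cong suc (sym (+-suc h h))) (s≤s (≤∧≢⇒< lo h≢)) , s≤s (m≤n⇒m≤1+n (≤-trans hi (≤-reflexive (sym (+-suc h h)))))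

numerators : ∀ p q L M → mkℚᵘ (ℤ.+ L) 0 ℚᵘ.≃ (ℚᵘ.1ℚᵘ ℚᵘ.+ mkℚᵘ +[1+ p ] q) ℚᵘ.* mkℚᵘ (ℤ.+ M) 0 →
             L * suc q ≡ (suc q + suc p) * M
numerators p q L M (*≡* e) = begin-equality
  L * suc q                                    ≡⟨ cong (L *_) (denominator q) ⟩
  L * (1 * suc q * 1)                          ≡⟨ ℤ.abs-* (ℤ.+ L) (ℚᵘ.↧ ((ℚᵘ.1ℚᵘ ℚᵘ.+ mkℚᵘ +[1+ p ] q) ℚᵘ.* mkℚᵘ (ℤ.+ M) 0)) ⟨
  ℤ.∣ ℤ.+ L ℤ.* ℚᵘ.↧ ((ℚᵘ.1ℚᵘ ℚᵘ.+ mkℚᵘ +[1+ p ] q) ℚᵘ.* mkℚᵘ (ℤ.+ M) 0) ∣ ≡⟨ cong ℤ.∣_∣ e ⟩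
  ℤ.∣ (num ℤ.* ℤ.+ M) ℤ.* ℤ.+ 1 ∣ ≡⟨ trans (ℤ.abs-* (num ℤ.* ℤ.+ M) (ℤ.+ 1)) (cong (_* 1) (ℤ.abs-* num (ℤ.+ M))) ⟩
  ℤ.∣ num ∣ * M * 1    ≡⟨ numerator q p M ⟩
  (suc q + suc p) * M                          ∎
  where
  open ≤-Reasoning
  num : ℤ.ℤ
  num = ℚᵘ.↥ (ℚᵘ.1ℚᵘ ℚᵘ.+ mkℚᵘ +[1+ p ] q)
  denominator : ∀ q → suc q ≡ 1 * suc q * 1
  denominator = solve-∀
  numerator : ∀ q p M → (suc (q + 0) + suc (p * 1)) * M * 1 ≡ (suc q + suc p) * M
  numerator = solve-∀

-- ε = (1 + p) / (1 + q).
size-ℕ : ∀ ε → 0ℚ ℚ.< ε → ∃[ p ] ∃[ q ] ∀ L M →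
         (ℤ.+ L) ℚ./ 1 ≡ (1ℚ ℚ.+ ε) ℚ.* ((ℤ.+ M) ℚ./ 1) → L * suc q ≡ (suc q + suc p) * M
size-ℕ ε@(mkℚ (ℤ.+ 0) q _) 0<ε = contradiction (ℚ.positive 0<ε) λ ()
size-ℕ ε@(mkℚ ℤ.-[1+ _ ] q _) 0<ε = contradiction (ℚ.positive 0<ε) λ ()
size-ℕ ε@(mkℚ +[1+ p ] q _) _ = p , q , λ L M eq → numerators p q L M (begin
  mkℚᵘ (ℤ.+ L) 0                             ≈⟨ ℚ.toℚᵘ-fromℚᵘ (mkℚᵘ (ℤ.+ L) 0) ⟨
  toℚᵘ ((ℤ.+ L) ℚ./ 1)                       ≡⟨ cong toℚᵘ eq ⟩
  toℚᵘ ((1ℚ ℚ.+ ε) ℚ.* ((ℤ.+ M) ℚ./ 1))      ≈⟨ ℚ.toℚᵘ-homo-* (1ℚ ℚ.+ ε) ((ℤ.+ M) ℚ./ 1) ⟩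
  toℚᵘ (1ℚ ℚ.+ ε) ℚᵘ.* toℚᵘ ((ℤ.+ M) ℚ./ 1)  ≈⟨ ℚᵘ.*-cong (ℚ.toℚᵘ-homo-+ 1ℚ ε) (ℚ.toℚᵘ-fromℚᵘ (mkℚᵘ (ℤ.+ M) 0)) ⟩
  (ℚᵘ.1ℚᵘ ℚᵘ.+ mkℚᵘ +[1+ p ] q) ℚᵘ.* mkℚᵘ (ℤ.+ M) 0 ∎)
  where
  open ℚᵘ.≃-Reasoning

-- Let X = L / n ! be the mean number of members on a maximal chain. Then N ≤ (1 + q) X, and N + X ≤
-- (1 + q) X + X ≤ N X. In this form it says X - 1 ≥ X / N, the share of pairs used in `total`.
excess : ∀ {n} p q (𝓕 : List (Subset n)) → Unique 𝓕 →
         length 𝓕 * suc q ≡ (suc q + suc p) * (n C (n / 2)) →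
         (suc q + suc p) * n ! + ∑S (λ S → member 𝓕 S ▸ FirstHit.W (member 𝓕) S)
           ≤ (suc q + suc p) * ∑S (λ S → member 𝓕 S ▸ FirstHit.W (member 𝓕) S)
excess {n} p q 𝓕 uniq size = begin
  N * n ! + L          ≤⟨ +-monoˡ-≤ L (*-cancelˡ-≤ M scaled) ⟩
  suc q * L + L        ≤⟨ +-monoʳ-≤ (suc q * L) (m≤n*m L (suc p)) ⟩
  suc q * L + suc p * L ≡⟨ *-distribʳ-+ L (suc q) (suc p) ⟨
  N * L                ∎
  where
  open ≤-Reasoning
  N M L : ℕ
  N = suc q + suc p
  M = n C (n / 2)
  W : Subset n → ℕ
  W = FirstHit.W (member 𝓕)
  L = ∑S (λ S → member 𝓕 S ▸ W S)
  n!≤M*W : ∀ S → n ! ≤ M * W S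
  n!≤M*W S = n!≤central n (rem false S) (rem true S) (trans (+-comm (rem false S) _) (rem-complement S))
  instance
    M≢0 : NonZero M
    M≢0 = ≢-nonZero λ M≡0 → contradiction (≤-trans (1≤n! n) (≤-trans (n!≤central n 0 n refl) (≤-reflexive (cong (_* (1 * n !)) M≡0)))) λ ()
  swap : ∀ a b c → a * (b * c) ≡ b * a * c
  swap = solve-∀
  swap′ : ∀ a b c → a * b * c ≡ b * (a * c)
  swap′ = solve-∀
  scaled : M * (N * n !) ≤ M * (suc q * L)
  scaled = begin
    M * (N * n !)                ≡⟨ swap M N (n !) ⟩
    N * M * n !                  ≡⟨ cong (_* n !) size ⟨
    length 𝓕 * suc q * n !       ≡⟨ swap′ (length 𝓕) (suc q) (n !) ⟩
    suc q * (length 𝓕 * n !)     ≤⟨ *-monoʳ-≤ (suc q) (length≤∑S (λ S → M * W S) (n !) 𝓕 uniq n!≤M*W) ⟩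
    suc q * ∑S (λ S → member 𝓕 S ▸ M * W S)
      ≡⟨ cong (suc q *_) (trans (∑S-cong λ S → sym (▸-*ˡ (member 𝓕 S) M (W S))) (∑S-* M (λ S → member 𝓕 S ▸ W S))) ⟩
    suc q * (M * L)              ≡⟨ trans (swap (suc q) M L) (*-assoc M (suc q) L) ⟩
    M * (suc q * L)              ∎

-- The band of levels and the choice of constants

near-half : ∀ {n s lo a} → lo + lo ≤ n ∸ s → n ∸ s ≤ suc (lo + lo) → n ≤ a + a + s → a + a ≤ n + s → lo ≤ a × a ≤ lo + s
near-half {n} {s} {lo} {a} lo≤ ≤lo n≤ ≤n = ≮⇒≥ a≮lo , ≮⇒≥ above
  where
  open ≤-Reasoning
  a≮lo : ¬ (a < lo)
  a≮lo a<lo = <-irrefl refl (begin-strict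
    a + a      <⟨ +-mono-< a<lo a<lo ⟩
    lo + lo    ≤⟨ lo≤ ⟩
    n ∸ s      ≤⟨ m≤n+o⇒m∸n≤o n s (≤-trans n≤ (≤-reflexive (+-comm (a + a) s))) ⟩
    a + a      ∎)
  regroup : ∀ l s → s + suc (l + l) + s ≡ suc ((l + s) + (l + s))
  regroup = solve-∀
  -- `lo` is (n - s) / 2 rounded down, which costs at most 1 in n - s; an integer a above `lo + s`
  -- adds 2 to the double, which outweighs this.
  above : ¬ (lo + s < a)
  above lt = <-irrefl refl (begin-strict
    a + a                        ≤⟨ ≤n ⟩
    n + s                        ≤⟨ +-monoˡ-≤ s (≤-trans (m≤n+m∸n n s) (+-monoʳ-≤ s ≤lo)) ⟩
    s + suc (lo + lo) + s        ≡⟨ regroup lo s ⟩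
    suc ((lo + s) + (lo + s))    ≤⟨ +-monoˡ-≤ (lo + s) lt ⟩
    a + (lo + s)                 <⟨ +-monoʳ-< a lt ⟩
    a + a                        ∎)

rem-range : ∀ {n s lo} (S : Subset n) → lo + lo ≤ n ∸ s → n ∸ s ≤ suc (lo + lo) → absDiff (2 * ∣ S ∣) n ≤ s →
            ∀ b → lo ≤ rem b S × rem b S ≤ lo + s
rem-range {n} {s} {lo} S lo≤ ≤lo dev = range
  where
  open ≤-Reasoning
  a c : ℕ
  a = rem false S
  c = rem true S
  total : c + a ≡ n
  total = rem-complement S
  2∣S∣ : 2 * ∣ S ∣ ≡ a + a
  2∣S∣ = trans (cong (2 *_) (sym (rem-false S))) (cong (a +_) (+-identityʳ a))
  n≤ : n ≤ a + a + s
  n≤ = subst (λ d → n ≤ d + s) 2∣S∣ (≤-trans (m≤n+m∸n n (2 * ∣ S ∣)) (+-monoʳ-≤ (2 * ∣ S ∣) (m+n≤o⇒n≤o (2 * ∣ S ∣ ∸ n) dev)))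
  ≤n : a + a ≤ n + s
  ≤n = subst (_≤ n + s) 2∣S∣ (≤-trans (m≤n+m∸n (2 * ∣ S ∣) n) (+-monoʳ-≤ n (m+n≤o⇒m≤o _ dev)))
  regroup : ∀ a c → (c + a) + (c + a) ≡ (a + a) + (c + c)
  regroup = solve-∀
  doubled : n + n ≡ (a + a) + (c + c)
  doubled = trans (sym (cong₂ _+_ total total)) (regroup a c)
  n≤′ : n ≤ c + c + s
  n≤′ = +-cancelˡ-≤ n _ _ (begin
    n + n              ≡⟨ doubled ⟩
    a + a + (c + c)    ≤⟨ +-monoˡ-≤ (c + c) ≤n ⟩
    n + s + (c + c)    ≡⟨ trans (+-assoc n s _) (cong (n +_) (+-comm s _)) ⟩
    n + (c + c + s)    ∎)
  ≤n′ : c + c ≤ n + s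
  ≤n′ = +-cancelˡ-≤ (a + a) _ _ (begin
    a + a + (c + c)    ≡⟨ doubled ⟨
    n + n              ≤⟨ +-monoʳ-≤ n n≤ ⟩
    n + (a + a + s)    ≡⟨ exchange n (a + a) s ⟩
    a + a + (n + s)    ∎)
    where
    exchange : ∀ x y z → x + (y + z) ≡ y + (x + z)
    exchange = solve-∀
  range : ∀ b → lo ≤ rem b S × rem b S ≤ lo + s
  range false = near-half lo≤ ≤lo n≤ ≤n
  range true  = near-half lo≤ ≤lo n≤′ ≤n′

narrow-range : ∀ {n s lo} c₀ → 4 ≤ n → 0 < s → s * (4 * suc c₀) ≤ n → n ∸ s ≤ suc (lo + lo) → n ≤ 4 * lo × c₀ * s < lo
narrow-range {n} {s} {lo} c₀ 4≤n s>0 s≤ ≤lo = n≤4lo , (begin-strict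
  c₀ * s        <⟨ +-monoˡ-< (c₀ * s) s>0 ⟩
  suc c₀ * s    ≤⟨ *-cancelˡ-≤ 4 (≤-trans (≤-trans (≤-reflexive (regroup s (suc c₀))) s≤) n≤4lo) ⟩
  lo           ∎)
  where
  open ≤-Reasoning
  regroup : ∀ s c → 4 * (c * s) ≡ s * (4 * c)
  regroup = solve-∀
  4s≤n : 4 * s ≤ n
  4s≤n = ≤-trans (≤-trans (≤-reflexive (*-comm 4 s)) (*-monoʳ-≤ s (m≤m*n 4 (suc c₀)))) s≤
  gather : ∀ s l → 2 * (s + suc (l + l)) ≡ 2 * suc s + 4 * l
  gather = solve-∀
  half-room : 2 * suc s ≤ n
  half-room = *-cancelˡ-≤ 2 (begin
    2 * (2 * suc s)  ≡⟨ expand s ⟩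
    4 * s + 4        ≤⟨ +-mono-≤ 4s≤n 4≤n ⟩
    n + n            ≡⟨ cong (n +_) (+-identityʳ n) ⟨
    2 * n            ∎)
    where
    expand : ∀ s → 2 * (2 * suc s) ≡ 4 * s + 4
    expand = solve-∀
  n≤4lo : n ≤ 4 * lo
  n≤4lo = +-cancelˡ-≤ n _ _ (begin
    n + n                     ≡⟨ cong (n +_) (+-identityʳ n) ⟨
    2 * n                     ≤⟨ *-monoʳ-≤ 2 (≤-trans (m≤n+m∸n n s) (+-monoʳ-≤ s ≤lo)) ⟩
    2 * (s + suc (lo + lo))   ≡⟨ gather s lo ⟩
    2 * suc s + 4 * lo        ≤⟨ +-monoˡ-≤ (4 * lo) half-room ⟩
    n + 4 * lo                ∎)

-- The second factor of R is c₀ + 1, where c₀ sums the three multipliers whose product with s has to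
-- stay below `lo`, so that c₀ s < lo serves all three. As `lo` is at least n / 4 and s = n / R, R =
-- 4 (c₀ + 1) suffices. The power of two is the threshold of `deviation`, and adding R keeps s
-- positive, which makes c₀ s < lo strict.
fence-in : ∀ k p q n → let N = suc q + suc p
                           K = double (suc k)
                           R = 4 * suc (256 * N * N * (2 + K) + (4 * N * K + 4 * N)) in
  2 ^ (3 * (16 * (R * R))) + R ≤ n → (𝓕 : List (Subset n)) → Unique 𝓕 → All (InBtilde n) 𝓕 →
  length 𝓕 * suc q ≡ N * (n C (n / 2)) → Fence (member 𝓕) K
fence-in k p q n large 𝓕 uniq inB size =
  let lo , lo≤ , ≤lo = half (n ∸ s)
      n≤4lo , Cs<lo = narrow-range {n} {s} {lo} c₀ (≤-trans (m≤m*n 4 (suc c₀)) R≤n) (m≥n⇒m/n>0 R≤n) (m/n*n≤m n R) ≤lo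
      range = λ b S S∈ → rem-range S lo≤ ≤lo (deviation≤ S S∈) b
      within : ∀ c → c ≤ c₀ → c * s < lo
      within c c≤ = ≤-<-trans (*-monoˡ-≤ s c≤) Cs<lo
  in FenceConstruction.build (member 𝓕) lo s N K (λ b S S∈ → proj₁ (range b S S∈)) (λ b S S∈ → proj₂ (range b S S∈))
       (≤-trans (s≤s z≤n) Cs<lo) (s≤s z≤n) n≤4lo
       (<⇒≤ (within (4 * N) (≤-trans (m≤n+m (4 * N) (4 * N * K)) (m≤n+m _ (256 * N * N * (2 + K))))))
       (within (256 * N * N * (2 + K)) (m≤m+n _ _))
       (within (4 * N * K) (≤-trans (m≤m+n _ (4 * N)) (m≤n+m _ (256 * N * N * (2 + K)))))
       K (dir-double false (suc k)) (s≤s z≤n) ≤-refl (≤-trans (s≤s z≤n) R≤n) (excess p q 𝓕 uniq size)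
  where
  N K c₀ R s : ℕ
  N = suc q + suc p
  K = double (suc k)
  c₀ = 256 * N * N * (2 + K) + (4 * N * K + 4 * N)
  R = 4 * suc c₀
  s = n / R
  R≤n : R ≤ n
  R≤n = m+n≤o⇒n≤o (2 ^ (3 * (16 * (R * R)))) large
  deviation≤ : ∀ S → member 𝓕 S ≡ true → absDiff (2 * ∣ S ∣) n ≤ s
  deviation≤ S S∈ = subst (_≤ s) (m*n/n≡m (absDiff (2 * ∣ S ∣) n) R)
    (/-monoˡ-≤ R (deviation R n (absDiff (2 * ∣ S ∣) n) (m+n≤o⇒m≤o _ large) (All.lookup inB (member-∈ 𝓕 S∈))))

-- Imported only here because +_ makes sections such as (x +_) ambiguous.
open import Data.Integer using (+_)

theorem2p2 : ∀ (k : ℕ) → 3 ≤ k → ∀ (ε : ℚ) → 0ℚ <ℚ ε →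
    ∃[ n₀ ] ∀ (n : ℕ) → n₀ ≤ n →
    ∀ (𝓕 : List (Subset n)) → Unique 𝓕 → All (InBtilde n) 𝓕 →
    (+ length 𝓕) /ℚ 1 ≡ (1ℚ +ℚ ε) *ℚ ((+ (n C (n / 2))) /ℚ 1) →
    Σ[ G ∈ (PElt k → Subset n) ]
    (Injective _≡_ _≡_ G
    × (∀ p → G p ∈ 𝓕)
    × (∀ p q → (p ≼ q) ⇔ (G p ⊆ G q))
    × (∀ (i j l : Fin k) → toℕ j ≡ 0 → toℕ l ≡ k ∸ 1 →
    1 ≤ toℕ i → toℕ i < k ∸ 1 →
    ¬ (G (inj₁ i) ⊆ (G (inj₁ j) ∪ G (inj₁ l)))))
theorem2p2 1 (s≤s ())
theorem2p2 2 (s≤s (s≤s ()))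
theorem2p2 (suc (suc (suc k))) _ ε ε>0 =
  let p , q , size = size-ℕ ε ε>0 in
  -- The threshold is solved from the first hypothesis of `fence-in` and depends on k and ε alone.
  _ , λ n large 𝓕 uniq inB eq →
    let module E = Embedding (member 𝓕) k (fence-in k p q n large 𝓕 uniq inB (size (length 𝓕) (n C (n / 2)) eq))
    in E.G , E.G-injective , (λ x → member-∈ 𝓕 (E.G-member x)) , E.G-⇔ , E.G-private
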